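{- At least one instance of the semigroup evaluation problem of size $N$ requires $\Omega(\mathrm{perm}_P(N,M,B))$ parallel I/Os in the CREW semigroup PEM model with $P\leq\frac{N}{B}$ processors.
   Context: The PEM model has $P$ processors, each with a private cache of $M$ cells, and a shared memory partitioned into blocks of $B$ contiguous cells; in one parallel I/O each processor may read or write at most one block between shared memory and its cache; CREW means concurrent reads allowed, exclusive writes; cost is the number of parallel I/Os. In the atomic PEM model every input element is an indivisible atom occupying one cell and revealing no information; operations are I/Os, copying and deleting atoms. The semigroup PEM model extends the atomic PEM by one operation: if atoms $x$ and $y$ are in the cache of a processor, a new atom $z=x\cdot y$ can be created. Semigroup evaluation: for a semigroup $S$ with associative operation $\cdot$, input atoms $x_1,\dots,x_N\in S$ stored in an array in shared memory, and a permutation $\pi$ of $[N]$, compute $\prod_{i=1}^N a_i$ where $a_i=x_{\pi(i)}$. A program is correct in the semigroup PEM if it computes the correct result for any input and any semigroup. Notation: $\overline{\log}(x)=\max\{1,\log x\}$, $d=\max\{2,\min\{\frac{M}{B},\frac{N}{PB}\}\}$, $\mathrm{perm}_P(N,M,B)=\min\left\{\frac{N}{P},\ \frac{N}{PB}\,\overline{\log}_d\frac{N}{B}\right\}$. -}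

module Defs where

open import Level using (0ℓ; Lift)
open import Algebra.Bundles using (Semigroup)
open import Data.Nat using (ℕ; zero; suc; _+_; _*_; _^_; _≤_; _<?_; _≡ᵇ_)
open import Data.Nat.Properties using (≤-total)
open import Data.Fin using (Fin; zero; suc; toℕ; fromℕ<)
import Data.Fin as F
open import Data.Fin.Permutation using (Permutation′; _⟨$⟩ʳ_)
open import Data.Maybe using (Maybe; just; nothing)
open import Data.Bool using (true; false; if_then_else_)
open import Data.List using (List; []; _∷_; foldr)
open import Data.List.Relation.Unary.All using (All)
open import Data.Product using (Σ; _×_; _,_)
open import Data.Sum using (_⊎_)
open import Data.Empty using (⊥)
open import Data.Unit using (⊤)
open import Relation.Nullary using (yes; no)
open import Relation.Binary.PropositionalEquality using (_≡_)
open import Data.List using (allFin) renaming (_++_ to _++L_)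

-- Atoms of the semigroup PEM model.
-- Since atoms reveal no information, a program is a fixed sequence of
-- operations; an atom is therefore represented symbolically by the
-- formal semigroup expression (over the N input atoms) it denotes.

data Term (N : ℕ) : Set where
  leaf : Fin N → Term N
  _⊗_  : Term N → Term N → Term N

eval : ∀ {N} (S : Semigroup 0ℓ 0ℓ) → (Fin N → Semigroup.Carrier S) →
       Term N → Semigroup.Carrier S
eval S x (leaf i) = x i
eval S x (t ⊗ u)  = Semigroup._∙_ S (eval S x t) (eval S x u)

prod : ∀ {n} (S : Semigroup 0ℓ 0ℓ) → (Fin (suc n) → Semigroup.Carrier S) →
       Semigroup.Carrier S
prod {zero}  S a = a zero
prod {suc n} S a = Semigroup._∙_ S (a zero) (prod S (λ i → a (suc i)))

-- Machine: shared memory (cells indexed by ℕ, block j = cells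
-- j*B .. j*B+B-1) and P private caches of M cells. A cell is empty
-- (nothing) or holds an atom.

record State (N P M : ℕ) : Set where
  field
    mem   : ℕ → Maybe (Term N)
    cache : Fin P → Fin M → Maybe (Term N)
open State public

update : ∀ {A : Set} {n} → (Fin n → A) → Fin n → A → Fin n → A
update f s a t with t F.≟ s
... | yes _ = a
... | no  _ = f t

updateℕ : ∀ {A : Set} → (ℕ → A) → ℕ → A → ℕ → A
updateℕ f i a x = if x ≡ᵇ i then a else f x

data LocalOp (M : ℕ) : Set where
  copy    : (src dst : Fin M) → LocalOp M
  delete  : Fin M → LocalOp M
  combine : (s t dst : Fin M) → LocalOp M

applyLocal : ∀ {N M} → LocalOp M → (Fin M → Maybe (Term N)) → (Fin M → Maybe (Term N))
applyLocal (copy s d) c = update c d (c s)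
applyLocal (delete s) c = update c s nothing
applyLocal (combine s t d) c with c s | c t
... | just x | just y = update c d (just (x ⊗ y))
... | _      | _      = c

data IOOp (M B : ℕ) : Set where
  -- read block j: cache cell s receives (a copy of) cell k of the block
  -- if r s = just k, and is unchanged if r s = nothing
  read  : (j : ℕ) (r : Fin M → Maybe (Fin B)) → IOOp M B
  -- write block j: cell k of the block receives (a copy of) the content
  -- of cache cell (w k) (the whole block is overwritten)
  write : (j : ℕ) (w : Fin B → Fin M) → IOOp M B

data Step (P M B : ℕ) : Set where
  local : Fin P → LocalOp M → Step P M B
  parIO : (Fin P → Maybe (IOOp M B)) → Step P M B

readInto : ∀ {N M B} → (ℕ → Maybe (Term N)) → ℕ → (Fin M → Maybe (Fin B)) →
           (Fin M → Maybe (Term N)) → (Fin M → Maybe (Term N))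
readInto {B = B} mem j r c s with r s
... | just k  = mem (j * B + toℕ k)
... | nothing = c s

writeFrom : ∀ {N M B} → (ℕ → Maybe (Term N)) → (Fin M → Maybe (Term N)) → ℕ →
            (Fin B → Fin M) → (ℕ → Maybe (Term N))
writeFrom {B = B} mem c j w =
  foldr (λ k m → updateℕ m (j * B + toℕ k) (c (w k))) mem (allFin B)

ioCache : ∀ {N M B} → (ℕ → Maybe (Term N)) → Maybe (IOOp M B) →
          (Fin M → Maybe (Term N)) → (Fin M → Maybe (Term N))
ioCache mem (just (read j r)) c = readInto mem j r c
ioCache mem _                 c = c

ioMem : ∀ {N M B} → (Fin M → Maybe (Term N)) → Maybe (IOOp M B) →
        (ℕ → Maybe (Term N)) → (ℕ → Maybe (Term N))
ioMem c (just (write j w)) mem = writeFrom mem c j w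
ioMem c _                  mem = mem

-- all reads see the shared memory before the step; writes use the caches
-- before the step (CREW: written blocks are distinct, see Valid)
exec : ∀ {N P M B} → Step P M B → State N P M → State N P M
exec (local p op) st = record st { cache = update (cache st) p (applyLocal op (cache st p)) }
exec {P = P} (parIO ops) st = record
  { mem   = foldr (λ p m → ioMem (cache st p) (ops p) m) (mem st) (allFin P)
  ; cache = λ p → ioCache (mem st) (ops p) (cache st p) }

run : ∀ {N P M B} → List (Step P M B) → State N P M → State N P M
run []       st = st
run (x ∷ xs) st = run xs (exec x st)

initial : (N P M : ℕ) → State N P M
initial N P M = record
  { mem   = λ a → cell a
  ; cache = λ _ _ → nothing }
  where
  cell : ℕ → Maybe (Term N)
  cell a with a <? N
  ... | yes a<N = just (leaf (fromℕ< a<N))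
  ... | no  _   = nothing

cost : ∀ {P M B} → List (Step P M B) → ℕ
cost []               = 0
cost (local _ _ ∷ xs) = cost xs
cost (parIO _ ∷ xs)   = suc (cost xs)

writesBlock : ∀ {M B} → Maybe (IOOp M B) → ℕ → Set
writesBlock (just (write j _)) j' = j ≡ j'
writesBlock _                  j' = ⊥

ValidStep : ∀ {P M B} → Step P M B → Set
ValidStep (local _ _) = ⊤
ValidStep (parIO ops) = ∀ p q j → writesBlock (ops p) j → writesBlock (ops q) j → p ≡ q

record Program (P M B : ℕ) : Set where
  field
    steps  : List (Step P M B)
    output : ℕ
open Program public

Valid : ∀ {P M B} → Program P M B → Set
Valid prog = All ValidStep (steps prog)

Correct : (N P M B : ℕ) → Permutation′ N → Program P M B → Set₁
Correct zero    P M B π prog = Lift _ ⊥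
Correct (suc n) P M B π prog =
  Σ (Term (suc n)) λ t →
    (mem (run (steps prog) (initial (suc n) P M)) (output prog) ≡ just t) ×
    (∀ (S : Semigroup 0ℓ 0ℓ) (x : Fin (suc n) → Semigroup.Carrier S) →
       Semigroup._≈_ S (eval S x t) (prod S (λ i → x (π ⟨$⟩ʳ i))))

-- The bound perm_P(N,M,B), compared exactly with natural numbers.
-- d = max{2, min{M/B, N/(PB)}} = dNum / dDen, where
-- min{M/B, N/(PB)} = min{MP, N} / (PB).

minℕ : ℕ → ℕ → ℕ
minℕ a b with ≤-total a b
... | _⊎_.inj₁ _ = a
... | _⊎_.inj₂ _ = b

dNum : (N M B P : ℕ) → ℕ
dNum N M B P with ≤-total (2 * (P * B)) (minℕ (M * P) N)
... | _⊎_.inj₁ _ = minℕ (M * P) N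
... | _⊎_.inj₂ _ = 2

dDen : (N M B P : ℕ) → ℕ
dDen N M B P with ≤-total (2 * (P * B)) (minℕ (M * P) N)
... | _⊎_.inj₁ _ = P * B
... | _⊎_.inj₂ _ = 1

-- AtLeastPerm x N M B P  ⇔  x ≥ perm_P(N,M,B) (real-valued comparison),
-- i.e. x ≥ N/P, or x ≥ (N/(PB)) · max{1, log_d(N/B)}.
-- With E = x·P·B the second disjunct is  E ≥ N  and  d^(E/N) ≥ N/B,
-- and the latter is equivalent to  (N/B)^N ≤ d^E,  i.e.
-- N^N · dDen^E ≤ dNum^E · B^N.
AtLeastPerm : (x N M B P : ℕ) → Set
AtLeastPerm x N M B P =
  (N ≤ x * P) ⊎
  ((N ≤ x * P * B) ×
   (N ^ N * dDen N M B P ^ (x * P * B) ≤ dNum N M B P ^ (x * P * B) * B ^ N))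

{-# OPTIONS --safe #-}
-- In the free semigroup the output atom must spell x_π(1) … x_π(N), so each input is used exactly once.
-- Tracing that word backwards gives at every time a list of distinct live locations; undoing a combine
-- splits a cache letter in two, undoing an I/O moves letters between caches and blocks.  Keeping only
-- the container (block or processor) of each location, a program with T parallel I/Os is described by
-- one block name per I/O and a bit string with O(TPB) ones and length O(T min{MP, N}), hence by
-- (5N)^{TP} · d^{O(TPB)} choices.  These choices determine the block of every x_π(i), while N! / B^N
-- different block sequences are needed.
module Submission where

open import Data.Bool as Bool using (Bool; false; true)
open import Data.Empty using (⊥-elim)
open import Data.Fin as F using (Fin; cast; fromℕ<; suc; toℕ; zero)
open import Data.Fin.Permutation using (Permutation′; _⟨$⟩ʳ_; _⟨$⟩ˡ_; inverseˡ; permutation)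
open import Data.Fin.Properties using (cast-is-id; cast-trans; combine-injective; injective⇒≤; toℕ-fromℕ<; toℕ-injective; toℕ<n)
open import Data.List using (List; []; [_]; _++_; _∷_; allFin; cartesianProductWith; concatMap; filter; foldr; length; lookup; map; mapMaybe; tabulate; upTo)
open import Data.List.Membership.Propositional using (_∈_; _∉_; lose)
open import Data.List.Membership.Propositional.Properties using (∈-++⁺ʳ; ∈-++⁺ˡ; ∈-allFin; ∈-cartesianProductWith⁺; ∈-concatMap⁺; ∈-lookup; ∈-map⁺; ∈-upTo⁺; ∈-∃++)
open import Data.List.Properties using (++-assoc; ++-identityʳ; ++-semigroup; length-++; length-map; length-mapMaybe; length-tabulate; length-upTo; map-id; tabulate-cong; tabulate-lookup)
open import Data.List.Relation.Binary.Permutation.Propositional using (_↭_; prep; ↭-refl; ↭-sym; ↭-trans; ↭⇒↭ₛ)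
open import Data.List.Relation.Binary.Permutation.Propositional.Properties using (shift; ↭-length; ∈-resp-↭)
import Data.List.Relation.Binary.Permutation.Setoid.Properties as SetoidPermutation
open import Data.List.Relation.Unary.All as All using (All; []; _∷_)
open import Data.List.Relation.Unary.AllPairs using ([]; _∷_)
open import Data.List.Relation.Unary.Any using (here; index; there)
open import Data.List.Relation.Unary.Any.Properties using (lookup-index)
open import Data.List.Relation.Unary.Unique.Propositional using (Unique)
open import Data.List.Relation.Unary.Unique.Propositional.Properties using (allFin⁺; tabulate⁺)
open import Data.Maybe as Maybe using (Maybe; just; maybe′; nothing)
open import Data.Maybe.Properties using (just-injective)
open import Data.Nat
open import Data.Nat.DivMod
open import Data.Nat.Divisibility using (n∣m*n)
open import Data.Nat.ListAction using (sum)
open import Data.Nat.Properties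
open import Data.Nat.Tactic.RingSolver using (solve-∀)
open import Data.Product using (_,_; _×_; proj₁; proj₂; Σ; ∃; ∃₂)
open import Data.Sum using ([_,_]′; _⊎_; inj₁; inj₂)
open import Data.Sum.Properties using (inj₁-injective; ≡-dec)
open import Data.Unit using (tt)
open import Data.Vec as Vec using (Vec; []; _∷_)
open import Data.Vec.Properties using (lookup∘tabulate)
open import Data.Vec.Relation.Unary.All as VecAll using ([]; _∷_)
import Data.Vec.Relation.Unary.All.Properties as VecAllP
open import Relation.Binary using (DecidableEquality)
open import Relation.Binary.PropositionalEquality using (_≡_; _≢_; cong; cong₂; refl; setoid; subst; sym; trans)
open import Relation.Nullary using (Dec; contradiction; no; yes)
open import Relation.Nullary.Decidable using (_×-dec_)
open import Defs

-- The live locations are kept in the order in which they spell the output. Undoing an I/O then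
-- needs only a subset of positions, not an assignment of letters to cells: at most `P * B` of the
-- at most `(d + 1) * (P * B)` live cache letters were just read, because no input occurs twice.
-- Choosing them costs about `log d` per letter, which is the source of the base `d`. Writes need no
-- choice, as every live letter of a written block goes back to its writer. Splits are cheap because
-- the word never exceeds `N` letters, and the number of local operations is irrelevant because
-- successive splits compose. Two obstacles remain. Memory is unbounded, so block names must be
-- compressed separately for each program; blocks that are neither written nor below `N` stay empty
-- and may share a name. Moreover the permutation is fixed before the program, so it has to defeat
-- all relevant costs at once.

-- Elementary estimates for powers and factorials.

^-distribʳ-* : ∀ m n o → (m * n) ^ o ≡ m ^ o * n ^ o
^-distribʳ-* m n zero    = refl
^-distribʳ-* m n (suc o) = trans (cong (m * n *_) (^-distribʳ-* m n o)) ([m*n]*[o*p]≡[m*o]*[n*p] m n (m ^ o) (n ^ o))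

-- Bernoulli's inequality (1 + 1/n)^j ≤ 1 + 2j/n, valid for 2j ≤ n.
suc-power-bound : ∀ n j → 2 * j ≤ n → suc n ^ j * n ≤ n ^ j * (n + 2 * j)
suc-power-bound n zero    _ = ≤-reflexive (identity n)
  where
  identity : ∀ n → 1 * n ≡ 1 * (n + 0)
  identity = solve-∀
suc-power-bound n (suc j) 2j+2≤n = begin
  suc n * suc n ^ j * n          ≡⟨ *-assoc (suc n) (suc n ^ j) n ⟩
  suc n * (suc n ^ j * n)        ≤⟨ *-monoʳ-≤ (suc n) (suc-power-bound n j 2j≤n) ⟩
  suc n * (n ^ j * (n + 2 * j))  ≡⟨ left n (n ^ j) (2 * j) ⟩
  n ^ j * (2 * j + (n * n + n * (2 * j) + n))  ≤⟨ *-monoʳ-≤ (n ^ j) (+-monoˡ-≤ _ 2j≤n) ⟩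
  n ^ j * (n + (n * n + n * (2 * j) + n))      ≡⟨ right n (n ^ j) j ⟩
  n * n ^ j * (n + 2 * suc j)    ∎
  where
  open ≤-Reasoning
  2j≤n : 2 * j ≤ n
  2j≤n = ≤-trans (*-monoʳ-≤ 2 (n≤1+n j)) 2j+2≤n
  left : ∀ n x y → suc n * (x * (n + y)) ≡ x * (y + (n * n + n * y + n))
  left = solve-∀
  right : ∀ n x j → x * (n + (n * n + n * (2 * j) + n)) ≡ n * x * (n + 2 * suc j)
  right = solve-∀

suc-power≤2* : ∀ n j → .{{NonZero n}} → 2 * j ≤ n → suc n ^ j ≤ 2 * n ^ j
suc-power≤2* n j 2j≤n = *-cancelʳ-≤ _ _ n (begin
  suc n ^ j * n          ≤⟨ suc-power-bound n j 2j≤n ⟩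
  n ^ j * (n + 2 * j)    ≤⟨ *-monoʳ-≤ (n ^ j) (+-monoʳ-≤ n 2j≤n) ⟩
  n ^ j * (n + n)        ≡⟨ identity n (n ^ j) ⟩
  2 * n ^ j * n          ∎)
  where
  open ≤-Reasoning
  identity : ∀ n x → x * (n + n) ≡ 2 * x * n
  identity = solve-∀

even⊎odd : ∀ n → ∃ λ m → n ≡ 2 * m ⊎ n ≡ suc (2 * m)
even⊎odd zero    = 0 , inj₁ refl
even⊎odd (suc n) with even⊎odd n
... | m , inj₁ refl = m , inj₂ refl
... | m , inj₂ refl = suc m , inj₁ (cong suc (sym (+-suc m (m + 0))))

-- A crude form of `(1 + 1/n) ^ n < e`: each half of the exponent contributes a factor 2, and for
-- odd `n` the leftover `(n + 1) / n` contributes another.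
suc-power≤8* : ∀ n → suc n ^ n ≤ 8 * n ^ n
suc-power≤8* zero    = s≤s z≤n
suc-power≤8* n@(suc _) with even⊎odd n
... | m , inj₁ eq = begin
  suc n ^ n                    ≡⟨ cong (suc n ^_) eq′ ⟩
  suc n ^ (m + m)              ≡⟨ ^-distribˡ-+-* (suc n) m m ⟩
  suc n ^ m * suc n ^ m        ≤⟨ *-mono-≤ half half ⟩
  (2 * n ^ m) * (2 * n ^ m)    ≡⟨ identity (n ^ m) ⟩
  4 * (n ^ m * n ^ m)          ≡⟨ cong (4 *_) (^-distribˡ-+-* n m m) ⟨
  4 * n ^ (m + m)              ≡⟨ cong (λ x → 4 * n ^ x) eq′ ⟨
  4 * n ^ n                    ≤⟨ *-monoˡ-≤ (n ^ n) (m≤m+n 4 4) ⟩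
  8 * n ^ n                    ∎
  where
  open ≤-Reasoning
  eq′ : n ≡ m + m
  eq′ = trans eq (cong (m +_) (+-identityʳ m))
  half = suc-power≤2* n m (≤-reflexive (sym eq))
  identity : ∀ x → (2 * x) * (2 * x) ≡ 4 * (x * x)
  identity = solve-∀
... | m , inj₂ eq = begin
  suc n ^ n                            ≡⟨ cong (suc n ^_) eq′ ⟩
  suc n * suc n ^ (m + m)              ≡⟨ cong (suc n *_) (^-distribˡ-+-* (suc n) m m) ⟩
  suc n * (suc n ^ m * suc n ^ m)      ≤⟨ *-mono-≤ (+-monoˡ-≤ n (s≤s (z≤n {n ∸ 1}))) (*-mono-≤ half half) ⟩
  (n + n) * ((2 * n ^ m) * (2 * n ^ m)) ≡⟨ identity n (n ^ m) ⟩
  8 * (n * (n ^ m * n ^ m))            ≡⟨ cong (λ x → 8 * (n * x)) (^-distribˡ-+-* n m m) ⟨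
  8 * n ^ suc (m + m)                  ≡⟨ cong (λ x → 8 * n ^ x) eq′ ⟨
  8 * n ^ n                            ∎
  where
  open ≤-Reasoning
  eq′ : n ≡ suc (m + m)
  eq′ = trans eq (cong (λ x → suc (m + x)) (+-identityʳ m))
  half = suc-power≤2* n m (≤-trans (n≤1+n _) (≤-reflexive (sym eq)))
  identity : ∀ n x → (n + n) * ((2 * x) * (2 * x)) ≡ 8 * (n * (x * x))
  identity = solve-∀

-- Replaces Stirling's formula: permutations are counted by `n !`, while `AtLeastPerm` is phrased
-- with `N ^ N`.
n^n≤8^n*n! : ∀ n → n ^ n ≤ 8 ^ n * n !
n^n≤8^n*n! zero    = s≤s z≤n
n^n≤8^n*n! (suc n) = begin
  suc n * suc n ^ n              ≤⟨ *-monoʳ-≤ (suc n) (suc-power≤8* n) ⟩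
  suc n * (8 * n ^ n)            ≤⟨ *-monoʳ-≤ (suc n) (*-monoʳ-≤ 8 (n^n≤8^n*n! n)) ⟩
  suc n * (8 * (8 ^ n * n !))    ≡⟨ identity (suc n) (8 ^ n) (n !) ⟩
  8 * 8 ^ n * (suc n * n !)      ∎
  where
  open ≤-Reasoning
  identity : ∀ n x y → n * (8 * (x * y)) ≡ 8 * x * (n * y)
  identity = solve-∀

-- Counting bit strings with few ones.

bitStrings : ℕ → ℕ → List (List Bool)
bitStrings zero    Θ       = [] ∷ []
bitStrings (suc Λ) zero    = map (false ∷_) (bitStrings Λ zero)
bitStrings (suc Λ) (suc Θ) = map (false ∷_) (bitStrings Λ (suc Θ)) ++ map (true ∷_) (bitStrings Λ Θ)

-- Give every string the weight q^(Λ - ones) ≥ q^(Λ - Θ); the weights of all strings sum to (q + 1)^Λ.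
bitStrings-weight : ∀ q .{{_ : NonZero q}} Λ Θ → length (bitStrings Λ Θ) * q ^ Λ ≤ q ^ Θ * suc q ^ Λ
bitStrings-weight q zero    Θ = *-monoˡ-≤ 1 (m^n>0 q Θ)
bitStrings-weight q (suc Λ) zero = begin
  length (bitStrings (suc Λ) zero) * (q * q ^ Λ)  ≡⟨ cong (_* (q * q ^ Λ)) (length-map _ (bitStrings Λ zero)) ⟩
  c * (q * q ^ Λ)        ≡⟨ identity c q (q ^ Λ) ⟩
  q * (c * q ^ Λ)        ≤⟨ *-mono-≤ (n≤1+n q) (bitStrings-weight q Λ zero) ⟩
  suc q * (1 * suc q ^ Λ) ≡⟨ cong (suc q *_) (*-identityˡ _) ⟩
  suc q * suc q ^ Λ      ≡⟨ *-identityˡ _ ⟨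
  1 * (suc q * suc q ^ Λ) ∎
  where
  open ≤-Reasoning
  c = length (bitStrings Λ zero)
  identity : ∀ c q x → c * (q * x) ≡ q * (c * x)
  identity = solve-∀
bitStrings-weight q (suc Λ) (suc Θ) = begin
  length (bitStrings (suc Λ) (suc Θ)) * (q * q ^ Λ)  ≡⟨ cong (_* (q * q ^ Λ)) split ⟩
  (c + c′) * (q * q ^ Λ)                             ≡⟨ left c c′ q (q ^ Λ) ⟩
  q * (c * q ^ Λ) + q * (c′ * q ^ Λ)                 ≤⟨ +-mono-≤ (*-monoʳ-≤ q (bitStrings-weight q Λ (suc Θ))) (*-monoʳ-≤ q (bitStrings-weight q Λ Θ)) ⟩
  q * (q * q ^ Θ * suc q ^ Λ) + q * (q ^ Θ * suc q ^ Λ) ≡⟨ right q (q ^ Θ) (suc q ^ Λ) ⟩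
  q * q ^ Θ * (suc q * suc q ^ Λ)                    ∎
  where
  open ≤-Reasoning
  c  = length (bitStrings Λ (suc Θ))
  c′ = length (bitStrings Λ Θ)
  split : length (bitStrings (suc Λ) (suc Θ)) ≡ c + c′
  split = trans (length-++ (map (false ∷_) (bitStrings Λ (suc Θ))))
                (cong₂ _+_ (length-map _ (bitStrings Λ (suc Θ))) (length-map _ (bitStrings Λ Θ)))
  left : ∀ c c′ q x → (c + c′) * (q * x) ≡ q * (c * x) + q * (c′ * x)
  left = solve-∀
  right : ∀ q x y → q * (q * x * y) + q * (x * y) ≡ q * x * (suc q * y)
  right = solve-∀

-- The choice `q = 2 * r` makes `(1 + 1/q) ^ r ≤ 2`, so the excess over `q ^ Θ` is only `2 ^ h`
-- although the strings have length `r * h`.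
length-bitStrings : ∀ r .{{_ : NonZero r}} h Θ → length (bitStrings (r * h) Θ) ≤ (2 * r) ^ Θ * 2 ^ h
length-bitStrings r h Θ = *-cancelʳ-≤ _ _ (q ^ (r * h)) {{m^n≢0 q (r * h)}} (begin
  length (bitStrings (r * h) Θ) * q ^ (r * h)  ≤⟨ bitStrings-weight q (r * h) Θ ⟩
  q ^ Θ * suc q ^ (r * h)        ≡⟨ cong (q ^ Θ *_) (^-*-assoc (suc q) r h) ⟨
  q ^ Θ * (suc q ^ r) ^ h        ≤⟨ *-monoʳ-≤ (q ^ Θ) (^-monoˡ-≤ h (suc-power≤2* q r ≤-refl)) ⟩
  q ^ Θ * (2 * q ^ r) ^ h        ≡⟨ cong (q ^ Θ *_) (^-distribʳ-* 2 (q ^ r) h) ⟩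
  q ^ Θ * (2 ^ h * (q ^ r) ^ h)  ≡⟨ cong (λ x → q ^ Θ * (2 ^ h * x)) (^-*-assoc q r h) ⟩
  q ^ Θ * (2 ^ h * q ^ (r * h))  ≡⟨ *-assoc (q ^ Θ) (2 ^ h) _ ⟨
  q ^ Θ * 2 ^ h * q ^ (r * h)    ∎)
  where
  open ≤-Reasoning
  q = 2 * r
  instance q≢0 : NonZero q
           q≢0 = m*n≢0 2 r

-- Comparing the number of traces with the factorial.

n≤2^n : ∀ n → n ≤ 2 ^ n
n≤2^n zero    = z≤n
n≤2^n (suc n) = begin
  suc n              ≤⟨ +-mono-≤ (m^n>0 2 n) (n≤2^n n) ⟩
  2 ^ n + 2 ^ n      ≡⟨ cong (2 ^ n +_) (+-identityʳ _) ⟨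
  2 ^ suc n          ∎
  where open ≤-Reasoning

2n≤2^n : ∀ n → .{{NonZero n}} → 2 * n ≤ 2 ^ n
2n≤2^n (suc n) = *-monoʳ-≤ 2 (1+n≤2^n n)
  where
  1+n≤2^n : ∀ n → suc n ≤ 2 ^ n
  1+n≤2^n zero    = ≤-refl
  1+n≤2^n (suc n) = ≤-trans (+-mono-≤ (m^n>0 2 n) (1+n≤2^n n)) (≤-reflexive (cong (2 ^ n +_) (sym (+-identityʳ _))))

^-cancelʳ-≤ : ∀ k .{{_ : NonZero k}} {m n} → m ^ k ≤ n ^ k → m ≤ n
^-cancelʳ-≤ k {m} {n} m^k≤n^k with m ≤? n
... | yes m≤n = m≤n
... | no  m≰n = contradiction m^k≤n^k (<⇒≱ (^-monoˡ-< k (≰⇒> m≰n)))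

-- The choices made in the backward trace of a program with T parallel I/Os: a name for the output
-- block, one of 5N operations per processor and step, and a bit string.
traceCount : (N P B d T : ℕ) → ℕ
traceCount N P B d T = 2 * N * ((5 * N) ^ P) ^ T * length (bitStrings (suc d * (3 * (T * P * B))) (3 * (T * P * B)))

module _ {N B P d T : ℕ} (5≤N : 5 ≤ N) (1≤B : 1 ≤ B) (1≤P : 1 ≤ P) (B≤N : B ≤ N) (2≤d : 2 ≤ d)
         (few : 27 * T * P ≤ N) (N≤2E : N ≤ 2 * (T * P * B))
         (small : d ^ (27 * T * P * B) * B ^ N ≤ N ^ N) where

  private
    E = T * P * B
    n = N ^ N
    b = B ^ N
    δ = d ^ (27 * E)
    Y = (5 * N) ^ (T * P)
    open ≤-Reasoning

    instance
      N≢0 : NonZero N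
      N≢0 = >-nonZero (≤-trans (s≤s z≤n) 5≤N)
      d≢0 : NonZero d
      d≢0 = >-nonZero (≤-trans (s≤s z≤n) 2≤d)
      5N≢0 : NonZero (5 * N)
      5N≢0 = m*n≢0 5 N
      8^N≢0 : NonZero (8 ^ N)
      8^N≢0 = m^n≢0 8 N

    δb≤n : δ * b ≤ n
    δb≤n = subst (λ e → d ^ e * b ≤ n) (identity T P B) small
      where
      identity : ∀ T P B → 27 * T * P * B ≡ 27 * (T * P * B)
      identity = solve-∀

    2^≤d^ : ∀ e → 2 ^ e ≤ d ^ e
    2^≤d^ e = ^-monoˡ-≤ e 2≤d

    δ-power : ∀ j → (d ^ (j * E)) ^ 27 ≡ δ ^ j
    δ-power j = trans (^-*-assoc d (j * E) 27) (trans (cong (d ^_) (identity j E)) (sym (^-*-assoc d (27 * E) j)))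
      where
      identity : ∀ j E → j * E * 27 ≡ 27 * E * j
      identity = solve-∀

    5n≤2^5B : N ≤ B * B → 5 * N ≤ 2 ^ (5 * B)
    5n≤2^5B N≤B² = begin
      5 * N                         ≤⟨ *-mono-≤ 5≤2^3B (≤-trans N≤B² (*-mono-≤ (n≤2^n B) (n≤2^n B))) ⟩
      2 ^ (3 * B) * (2 ^ B * 2 ^ B) ≡⟨ cong (2 ^ (3 * B) *_) (^-distribˡ-+-* 2 B B) ⟨
      2 ^ (3 * B) * 2 ^ (B + B)     ≡⟨ ^-distribˡ-+-* 2 (3 * B) (B + B) ⟨
      2 ^ (3 * B + (B + B))         ≡⟨ cong (2 ^_) (identity B) ⟩
      2 ^ (5 * B)                   ∎
      where
      identity : ∀ B → 3 * B + (B + B) ≡ 5 * B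
      identity = solve-∀
      5≤2^3B : 5 ≤ 2 ^ (3 * B)
      5≤2^3B = ≤-trans (m≤m+n 5 3) (^-monoʳ-≤ 2 (*-monoʳ-≤ 3 1≤B))

    -- Naming blocks costs log N per I/O: this is O(B) when N ≤ B², and otherwise the TP ≤ N/27 names
    -- cost together only a fraction of N log (N/B).
    names-bound : Y ^ 27 * b ^ 5 ≤ n ^ 5
    names-bound with ≤-total N (B * B)
    ... | inj₁ N≤B² = begin
      Y ^ 27 * b ^ 5                ≤⟨ *-monoˡ-≤ (b ^ 5) (^-monoˡ-≤ 27 Y≤) ⟩
      (d ^ (5 * E)) ^ 27 * b ^ 5    ≡⟨ cong (_* b ^ 5) (δ-power 5) ⟩
      δ ^ 5 * b ^ 5                 ≡⟨ ^-distribʳ-* δ b 5 ⟨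
      (δ * b) ^ 5                   ≤⟨ ^-monoˡ-≤ 5 δb≤n ⟩
      n ^ 5                         ∎
      where
      identity : ∀ T P B → 5 * B * (T * P) ≡ 5 * (T * P * B)
      identity = solve-∀
      Y≤ : Y ≤ d ^ (5 * E)
      Y≤ = begin
        (5 * N) ^ (T * P)         ≤⟨ ^-monoˡ-≤ (T * P) (5n≤2^5B N≤B²) ⟩
        (2 ^ (5 * B)) ^ (T * P)   ≡⟨ ^-*-assoc 2 (5 * B) (T * P) ⟩
        2 ^ (5 * B * (T * P))     ≡⟨ cong (2 ^_) (identity T P B) ⟩
        2 ^ (5 * E)               ≤⟨ 2^≤d^ (5 * E) ⟩
        d ^ (5 * E)               ∎
    ... | inj₂ B²≤N = begin
      Y ^ 27 * b ^ 5                          ≡⟨ cong (_* b ^ 5) (^-*-assoc (5 * N) (T * P) 27) ⟩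
      (5 * N) ^ (T * P * 27) * b ^ 5          ≤⟨ *-monoˡ-≤ (b ^ 5) (^-monoʳ-≤ (5 * N) few′) ⟩
      (5 * N) ^ N * b ^ 5                     ≤⟨ *-monoˡ-≤ (b ^ 5) (^-monoˡ-≤ N (*-monoˡ-≤ N 5≤N)) ⟩
      (N * N) ^ N * b ^ 5                     ≡⟨ cong₂ _*_ (^-distribʳ-* N N N) (identity b) ⟩
      n * n * (b * b * (b * b) * b)           ≤⟨ *-monoʳ-≤ (n * n) (*-mono-≤ (*-mono-≤ bb≤n bb≤n) (^-monoˡ-≤ N B≤N)) ⟩
      n * n * (n * n * n)                     ≡⟨ identity′ n ⟩
      n ^ 5                                   ∎
      where
      few′ : T * P * 27 ≤ N
      few′ = ≤-trans (≤-reflexive (trans (*-comm (T * P) 27) (sym (*-assoc 27 T P)))) few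
      bb≤n : b * b ≤ n
      bb≤n = ≤-trans (≤-reflexive (sym (^-distribʳ-* B B N))) (^-monoˡ-≤ N B²≤N)
      identity : ∀ b → b * (b * (b * (b * (b * 1)))) ≡ b * b * (b * b) * b
      identity = solve-∀
      identity′ : ∀ n → n * n * (n * n * n) ≡ n * (n * (n * (n * (n * 1))))
      identity′ = solve-∀

    2r≤d^3 : 2 * suc d ≤ d ^ 3
    2r≤d^3 = begin
      2 * suc d          ≡⟨⟩
      2 * (1 + d)        ≤⟨ *-monoʳ-≤ 2 (+-monoˡ-≤ d (≤-trans (s≤s z≤n) 2≤d)) ⟩
      2 * (d + d)        ≡⟨ identity d ⟩
      2 * 2 * d          ≤⟨ *-monoˡ-≤ d (*-mono-≤ 2≤d 2≤d) ⟩
      d * d * d          ≡⟨ identity′ d ⟩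
      d ^ 3              ∎
      where
      identity : ∀ d → 2 * (d + d) ≡ 2 * 2 * d
      identity = solve-∀
      identity′ : ∀ d → d * d * d ≡ d * (d * (d * 1))
      identity′ = solve-∀

    c = length (bitStrings (suc d * (3 * E)) (3 * E))

    -- Since `2 * suc d ≤ d ^ 3`, the at most `3 * E` ones cost `9 * E` in the exponent of `d`; the
    -- factor `2 ^ (3 * E)` adds the remaining `3 * E`.
    c≤ : c ≤ d ^ (12 * E)
    c≤ = begin
      c                                  ≤⟨ length-bitStrings (suc d) (3 * E) (3 * E) ⟩
      (2 * suc d) ^ (3 * E) * 2 ^ (3 * E) ≤⟨ *-mono-≤ (^-monoˡ-≤ (3 * E) 2r≤d^3) (2^≤d^ (3 * E)) ⟩
      (d ^ 3) ^ (3 * E) * d ^ (3 * E)    ≡⟨ cong (_* d ^ (3 * E)) (^-*-assoc d 3 (3 * E)) ⟩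
      d ^ (3 * (3 * E)) * d ^ (3 * E)    ≡⟨ ^-distribˡ-+-* d (3 * (3 * E)) (3 * E) ⟨
      d ^ (3 * (3 * E) + 3 * E)          ≡⟨ cong (d ^_) (identity E) ⟩
      d ^ (12 * E)                       ∎
      where
      identity : ∀ E → 3 * (3 * E) + 3 * E ≡ 12 * E
      identity = solve-∀

    -- Collects the factors governed by `N` alone: `2 * N` names for the output block, `2 * N`
    -- reserved for the union over all costs, and `8 ^ N` from passing to `N !`. Together they are
    -- at most `2 ^ (5 * N)`, which `N≤2E` charges to `d ^ (10 * E)`.
    a = 2 * N * (2 * N) * 8 ^ N

    a≤ : a ≤ d ^ (10 * E)
    a≤ = begin
      2 * N * (2 * N) * 8 ^ N     ≤⟨ *-monoˡ-≤ (8 ^ N) (*-mono-≤ (2n≤2^n N) (2n≤2^n N)) ⟩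
      2 ^ N * 2 ^ N * 8 ^ N       ≡⟨ cong (2 ^ N * 2 ^ N *_) (^-*-assoc 2 3 N) ⟩
      2 ^ N * 2 ^ N * 2 ^ (3 * N) ≡⟨ cong (_* 2 ^ (3 * N)) (^-distribˡ-+-* 2 N N) ⟨
      2 ^ (N + N) * 2 ^ (3 * N)   ≡⟨ ^-distribˡ-+-* 2 (N + N) (3 * N) ⟨
      2 ^ (N + N + 3 * N)         ≡⟨ cong (2 ^_) (identity N) ⟩
      2 ^ (5 * N)                 ≤⟨ ^-monoʳ-≤ 2 (*-monoʳ-≤ 5 N≤2E) ⟩
      2 ^ (5 * (2 * E))           ≡⟨ cong (2 ^_) (*-assoc 5 2 E) ⟨
      2 ^ (10 * E)                ≤⟨ 2^≤d^ (10 * E) ⟩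
      d ^ (10 * E)                ∎
      where
      identity : ∀ N → N + N + 3 * N ≡ 5 * N
      identity = solve-∀

    S = a * c * Y

    S≤ : S ≤ d ^ (22 * E) * Y
    S≤ = *-monoˡ-≤ Y (begin
      a * c                          ≤⟨ *-mono-≤ a≤ c≤ ⟩
      d ^ (10 * E) * d ^ (12 * E)    ≡⟨ ^-distribˡ-+-* d (10 * E) (12 * E) ⟨
      d ^ (10 * E + 12 * E)          ≡⟨ cong (d ^_) (*-distribʳ-+ E 10 12) ⟨
      d ^ (22 * E)                   ∎)

    Sb≤n : S * b ≤ n
    -- The 27th power avoids fractional exponents. Of 27 factors `n / b`, the power `d ^ (22 * E)`
    -- uses 22 through `δb≤n`, and the block names use the other 5.
    Sb≤n = ^-cancelʳ-≤ 27 (begin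
      (S * b) ^ 27                            ≡⟨ ^-distribʳ-* S b 27 ⟩
      S ^ 27 * b ^ 27                         ≤⟨ *-monoˡ-≤ (b ^ 27) (^-monoˡ-≤ 27 S≤) ⟩
      (d ^ (22 * E) * Y) ^ 27 * b ^ 27        ≡⟨ cong₂ _*_ (^-distribʳ-* (d ^ (22 * E)) Y 27) (^-distribˡ-+-* b 22 5) ⟩
      (d ^ (22 * E)) ^ 27 * Y ^ 27 * (b ^ 22 * b ^ 5)
                                              ≡⟨ cong (λ x → x * Y ^ 27 * (b ^ 22 * b ^ 5)) (δ-power 22) ⟩
      δ ^ 22 * Y ^ 27 * (b ^ 22 * b ^ 5)      ≡⟨ [m*n]*[o*p]≡[m*o]*[n*p] (δ ^ 22) (Y ^ 27) (b ^ 22) (b ^ 5) ⟩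
      δ ^ 22 * b ^ 22 * (Y ^ 27 * b ^ 5)      ≡⟨ cong (_* (Y ^ 27 * b ^ 5)) (^-distribʳ-* δ b 22) ⟨
      (δ * b) ^ 22 * (Y ^ 27 * b ^ 5)         ≤⟨ *-mono-≤ (^-monoˡ-≤ 22 δb≤n) names-bound ⟩
      n ^ 22 * n ^ 5                          ≡⟨ ^-distribˡ-+-* n 22 5 ⟨
      n ^ 27                                  ∎)

  traceCount-bound : traceCount N P B d T * (2 * N * B ^ N) ≤ N !
  traceCount-bound = *-cancelˡ-≤ (8 ^ N) (begin
    8 ^ N * (2 * N * ((5 * N) ^ P) ^ T * c * (2 * N * b))
      ≡⟨ cong (λ x → 8 ^ N * (2 * N * x * c * (2 * N * b))) (trans (^-*-assoc (5 * N) P T) (cong ((5 * N) ^_) (*-comm P T))) ⟩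
    8 ^ N * (2 * N * Y * c * (2 * N * b))  ≡⟨ identity (8 ^ N) (2 * N) Y c b ⟩
    S * b                                  ≤⟨ Sb≤n ⟩
    N ^ N                                  ≤⟨ n^n≤8^n*n! N ⟩
    8 ^ N * N !                            ∎)
    where
    identity : ∀ e m y c b → e * (m * y * c * (m * b)) ≡ m * m * e * c * y * b
    identity = solve-∀

-- Lists with distinct entries, enumerations and averages.

private variable
  A C : Set

Unique-resp-↭ : {xs ys : List A} → xs ↭ ys → Unique xs → Unique ys
Unique-resp-↭ {A = A} p = SetoidPermutation.Unique-resp-↭ (setoid A) (↭⇒↭ₛ p)

lookup-injective : {xs : List A} → Unique xs → ∀ {i j} → lookup xs i ≡ lookup xs j → i ≡ j
lookup-injective (_ ∷ _)  {zero}  {zero}  _  = refl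
lookup-injective (x∉ ∷ _) {zero}  {suc j} eq = contradiction eq (All.lookup x∉ (∈-lookup j))
lookup-injective (x∉ ∷ _) {suc i} {zero}  eq = contradiction (sym eq) (All.lookup x∉ (∈-lookup i))
lookup-injective (_ ∷ u)  {suc i} {suc j} eq = cong suc (lookup-injective u eq)

-- Distinctness is asked of the keys `g x`: one block cell may be read into several cache cells, so
-- in the application to I/Os the value of `f` fixes only the source of a location, not the location
-- itself.
mapMaybe-unique : {D : Set} (f : A → Maybe C) (g : A → D) → (∀ {x y c} → f x ≡ just c → f y ≡ just c → g x ≡ g y) →
                  ∀ xs → Unique (map g xs) → Unique (mapMaybe f xs)
mapMaybe-unique f g inj []       _        = []
mapMaybe-unique f g inj (x ∷ xs) (x∉ ∷ u) with f x in eq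
... | nothing = mapMaybe-unique f g inj xs u
... | just c  = fresh xs x∉ ∷ mapMaybe-unique f g inj xs u
  where
  fresh : ∀ ys → All (g x ≢_) (map g ys) → All (c ≢_) (mapMaybe f ys)
  fresh []       []           = []
  fresh (y ∷ ys) (x≢y ∷ rest) with f y in eq′
  ... | nothing = fresh ys rest
  ... | just _  = (λ { refl → x≢y (inj eq eq′) }) ∷ fresh ys rest

length-mapMaybe-≤ : ∀ {n} {D : Set} (f : A → Maybe (Fin n)) (g : A → D) →
                    (∀ {x y i} → f x ≡ just i → f y ≡ just i → g x ≡ g y) →
                    ∀ xs → Unique (map g xs) → length (mapMaybe f xs) ≤ n
length-mapMaybe-≤ f g inj xs u = injective⇒≤ (lookup-injective (mapMaybe-unique f g inj xs u))

length-cartesianProductWith : {D : Set} (f : A → C → D) (xs : List A) (ys : List C) →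
                              length (cartesianProductWith f xs ys) ≡ length xs * length ys
length-cartesianProductWith f []       ys = refl
length-cartesianProductWith f (x ∷ xs) ys =
  trans (length-++ (map (f x) ys)) (cong₂ _+_ (length-map (f x) ys) (length-cartesianProductWith f xs ys))

vectors : List A → (n : ℕ) → List (Vec A n)
vectors xs zero    = [] ∷ []
vectors xs (suc n) = cartesianProductWith _∷_ xs (vectors xs n)

length-vectors : (xs : List A) (n : ℕ) → length (vectors xs n) ≡ length xs ^ n
length-vectors xs zero    = refl
length-vectors xs (suc n) = trans (length-cartesianProductWith _∷_ xs (vectors xs n)) (cong (length xs *_) (length-vectors xs n))

∈-vectors : {xs : List A} {n : ℕ} {v : Vec A n} → VecAll.All (_∈ xs) v → v ∈ vectors xs n
∈-vectors VecAll.[]         = here refl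
∈-vectors (x∈ VecAll.∷ v∈) = ∈-cartesianProductWith⁺ _∷_ x∈ (∈-vectors v∈)

ones : List Bool → ℕ
ones []           = 0
ones (true ∷ bs)  = suc (ones bs)
ones (false ∷ bs) = ones bs

ones-++ : ∀ bs cs → ones (bs ++ cs) ≡ ones bs + ones cs
ones-++ []           cs = refl
ones-++ (true ∷ bs)  cs = cong suc (ones-++ bs cs)
ones-++ (false ∷ bs) cs = ones-++ bs cs

∈-bitStrings : ∀ bs {Λ Θ} → length bs ≡ Λ → ones bs ≤ Θ → bs ∈ bitStrings Λ Θ
∈-bitStrings []           refl _ = here refl
∈-bitStrings (false ∷ bs) {Θ = zero}  refl le = ∈-map⁺ (false ∷_) (∈-bitStrings bs refl le)
∈-bitStrings (false ∷ bs) {Θ = suc Θ} refl le = ∈-++⁺ˡ (∈-map⁺ (false ∷_) (∈-bitStrings bs refl le))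
∈-bitStrings (true ∷ bs)  {Θ = suc Θ} refl (s≤s le) =
  ∈-++⁺ʳ (map (false ∷_) (bitStrings (length bs) (suc Θ))) (∈-map⁺ (true ∷_) (∈-bitStrings bs refl le))

length-concatMap-≤ : ∀ (f : A → List C) xs {u v} → (∀ x → length (f x) * u ≤ v) →
                     length (concatMap f xs) * u ≤ length xs * v
length-concatMap-≤ f []       _ = z≤n
length-concatMap-≤ f (x ∷ xs) {u} {v} bound = begin
  length (f x ++ concatMap f xs) * u               ≡⟨ cong (_* u) (length-++ (f x)) ⟩
  (length (f x) + length (concatMap f xs)) * u     ≡⟨ *-distribʳ-+ u (length (f x)) _ ⟩
  length (f x) * u + length (concatMap f xs) * u   ≤⟨ +-mono-≤ (bound x) (length-concatMap-≤ f xs bound) ⟩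
  v + length xs * v                                ∎
  where open ≤-Reasoning

below-average : (f : A → ℕ) (x : A) (xs : List A) →
                ∃ λ y → y ∈ x ∷ xs × f y * length (x ∷ xs) ≤ sum (map f (x ∷ xs))
below-average f x [] = x , here refl , ≤-reflexive (trans (*-identityʳ (f x)) (sym (+-identityʳ (f x))))
below-average f x (x′ ∷ xs) with below-average f x′ xs
... | y , y∈ , le with ≤-total (f x) (f y)
...   | inj₁ fx≤fy = x , here refl , (begin
    f x * suc (length (x′ ∷ xs))       ≡⟨ *-suc (f x) _ ⟩
    f x + f x * length (x′ ∷ xs)       ≤⟨ +-monoʳ-≤ (f x) (≤-trans (*-monoˡ-≤ _ fx≤fy) le) ⟩
    f x + sum (map f (x′ ∷ xs))        ∎)
  where open ≤-Reasoning
...   | inj₂ fy≤fx = y , there y∈ , (begin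
    f y * suc (length (x′ ∷ xs))       ≡⟨ *-suc (f y) _ ⟩
    f y + f y * length (x′ ∷ xs)       ≤⟨ +-mono-≤ fy≤fx le ⟩
    f x + sum (map f (x′ ∷ xs))        ∎)
  where open ≤-Reasoning

-- Rearranging elements so that their classes avoid a short list of words.

module Avoidance (_≟ᶜ_ : DecidableEquality C) (β : A → C) (B : ℕ)
                 (classSize : ∀ {R} → Unique R → ∀ c → length (filter (λ e → β e ≟ᶜ c) R) ≤ B) where

  tailAfter : C → List C → Maybe (List C)
  tailAfter c []      = nothing
  tailAfter c (x ∷ w) with c ≟ᶜ x
  ... | yes _ = just w
  ... | no  _ = nothing

  tailsAfter : C → List (List C) → List (List C)
  tailsAfter c = mapMaybe (tailAfter c)

  ∈-tailsAfter : ∀ c w L → c ∷ w ∈ L → w ∈ tailsAfter c L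
  ∈-tailsAfter c w (_ ∷ L) (here refl) with c ≟ᶜ c
  ... | yes _  = here refl
  ... | no c≢c = contradiction refl c≢c
  ∈-tailsAfter c w (v ∷ L) (there w∈) with tailAfter c v
  ... | just _  = there (∈-tailsAfter c w L w∈)
  ... | nothing = ∈-tailsAfter c w L w∈

  sum-tailsAfter-∷ : ∀ x w L R → sum (map (λ e → length (tailsAfter (β e) ((x ∷ w) ∷ L))) R) ≡
                     length (filter (λ e → β e ≟ᶜ x) R) + sum (map (λ e → length (tailsAfter (β e) L)) R)
  sum-tailsAfter-∷ x w L []      = refl
  sum-tailsAfter-∷ x w L (e ∷ R) with β e ≟ᶜ x
  ... | yes _ = cong suc (trans (cong (length (tailsAfter (β e) L) +_) (sum-tailsAfter-∷ x w L R))
                                (identity (length (tailsAfter (β e) L)) (length (filter (λ e → β e ≟ᶜ x) R)) _))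
    where
    identity : ∀ a b c → a + (b + c) ≡ b + (a + c)
    identity = solve-∀
  ... | no  _ = trans (cong (length (tailsAfter (β e) L) +_) (sum-tailsAfter-∷ x w L R))
                      (identity (length (tailsAfter (β e) L)) (length (filter (λ e → β e ≟ᶜ x) R)) _)
    where
    identity : ∀ a b c → a + (b + c) ≡ b + (a + c)
    identity = solve-∀

  -- Double counting: a nonempty word is counted once for each `e` in `R` whose class is its first
  -- letter, so at most `B` times, and the empty word never.
  sum-tailsAfter : ∀ L {R} → Unique R → sum (map (λ e → length (tailsAfter (β e) L)) R) ≤ length L * B
  sum-tailsAfter [] {R} _ = ≤-reflexive (zeros R)
    where
    zeros : ∀ R → sum (map (λ _ → 0) R) ≡ 0
    zeros []      = refl
    zeros (_ ∷ R) = zeros R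
  sum-tailsAfter ([] ∷ L)      u = ≤-trans (sum-tailsAfter L u) (m≤n+m _ B)
  sum-tailsAfter ((x ∷ w) ∷ L) {R} u =
    ≤-trans (≤-reflexive (sum-tailsAfter-∷ x w L R)) (+-mono-≤ (classSize u x) (sum-tailsAfter L u))

  -- The elements are placed one by one; by averaging, some e has at most |L| B / n words of L beginning with β e.
  avoid : ∀ n {R} L → length R ≡ n → Unique R → length L * B ^ n < n ! → ∃ λ R′ → R′ ↭ R × map β R′ ∉ L
  avoid zero    {[]}    []      _    _ _ = [] , ↭-refl , λ ()
  avoid zero    {[]}    (_ ∷ _) _    _ (s≤s ())
  avoid (suc n) {e ∷ R} L       len  u few with below-average (λ e → length (tailsAfter (β e) L)) e R
  ... | y , y∈ , le with ∈-∃++ y∈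
  ...   | xs , ys , eq = y ∷ R′ , ↭-trans (prep y R′↭) (↭-sym split) , λ w∈ → R′∉ (∈-tailsAfter (β y) _ L w∈)
    where
    open ≤-Reasoning
    split : e ∷ R ↭ y ∷ xs ++ ys
    split = subst (_↭ y ∷ xs ++ ys) (sym eq) (shift y xs ys)
    unique′ : Unique (y ∷ xs ++ ys)
    unique′ = Unique-resp-↭ split u
    L′ = tailsAfter (β y) L
    few′ : length L′ * B ^ n < n !
    few′ = *-cancelʳ-< (suc n) _ _ (begin-strict
      length L′ * B ^ n * suc n    ≡⟨ identity (length L′) (B ^ n) (suc n) ⟩
      length L′ * suc n * B ^ n    ≡⟨ cong (λ l → length L′ * l * B ^ n) len ⟨
      length L′ * length (e ∷ R) * B ^ n  ≤⟨ *-monoˡ-≤ (B ^ n) (≤-trans le (sum-tailsAfter L u)) ⟩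
      length L * B * B ^ n         ≡⟨ *-assoc (length L) B (B ^ n) ⟩
      length L * B ^ suc n         <⟨ few ⟩
      suc n * n !                  ≡⟨ *-comm (suc n) (n !) ⟩
      n ! * suc n                  ∎)
      where
      identity : ∀ a b c → a * b * c ≡ a * c * b
      identity = solve-∀
    rest : ∃ λ R′ → R′ ↭ xs ++ ys × map β R′ ∉ L′
    rest with _ ∷ u′ ← unique′ = avoid n L′ (suc-injective (trans (sym (↭-length split)) len)) u′ few′
    R′   = proj₁ rest
    R′↭  = proj₁ (proj₂ rest)
    R′∉  = proj₂ (proj₂ rest)

↭allFin⇒permutation : ∀ {n} {xs : List (Fin n)} → xs ↭ allFin n → ∃ λ (π : Permutation′ n) → tabulate (π ⟨$⟩ʳ_) ≡ xs
↭allFin⇒permutation {n} {xs} xs↭ = permutation f g f∘g (λ i → f-injective (f∘g (f i))) , tabulate-lookup-cast xs n≡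
  where
  n≡ : n ≡ length xs
  n≡ = trans (sym (length-tabulate (λ i → i))) (sym (↭-length xs↭))
  f : Fin n → Fin n
  f i = lookup xs (cast n≡ i)
  unique : Unique xs
  unique = Unique-resp-↭ (↭-sym xs↭) (allFin⁺ n)
  cast-injective : ∀ {m} (eq : n ≡ m) {i j : Fin n} → cast eq i ≡ cast eq j → i ≡ j
  cast-injective refl {i} {j} p = trans (sym (cast-is-id refl i)) (trans p (cast-is-id refl j))
  f-injective : ∀ {i j} → f i ≡ f j → i ≡ j
  f-injective p = cast-injective n≡ (lookup-injective unique p)
  j∈xs : ∀ j → j ∈ xs
  j∈xs j = ∈-resp-↭ (↭-sym xs↭) (∈-allFin j)
  g : Fin n → Fin n
  g j = cast (sym n≡) (index (j∈xs j))
  f∘g : ∀ j → f (g j) ≡ j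
  f∘g j = trans (cong (lookup xs) (trans (cast-trans (sym n≡) n≡ _) (cast-is-id _ _))) (sym (lookup-index (j∈xs j)))
  tabulate-lookup-cast : ∀ {m} {A : Set} (ys : List A) (eq : m ≡ length ys) → tabulate (λ i → lookup ys (cast eq i)) ≡ ys
  tabulate-lookup-cast ys refl = trans (tabulate-cong (λ i → cong (lookup ys) (cast-is-id refl i))) (tabulate-lookup ys)

-- Coarse traces: encoding and decoding.

-- A container is a (renamed) memory block or the cache of a processor.
Container : ℕ → Set
Container P = ℕ ⊎ Fin P

-- Only the block name is recorded. Which letters a read transferred is left to the bits of
-- `Select`; for a write the name alone decides.
data CoarseOp : Set where
  idle      : CoarseOp
  rd wr     : ℕ → CoarseOp

caches blocks : ∀ {P} → List (Container P) → ℕ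
caches []           = 0
caches (inj₁ _ ∷ W) = caches W
caches (inj₂ _ ∷ W) = suc (caches W)
blocks []           = 0
blocks (inj₁ _ ∷ W) = suc (blocks W)
blocks (inj₂ _ ∷ W) = blocks W

-- Undoing combine operations repeats cache letters; each bit says whether the current letter is repeated.
data Expand {P} : List Bool → List (Container P) → List (Container P) → Set where
  []    : Expand [] [] []
  block : ∀ {bs W W′ j} → Expand bs W W′ → Expand bs (inj₁ j ∷ W) (inj₁ j ∷ W′)
  keep  : ∀ {bs W W′ p} → Expand bs W W′ → Expand (false ∷ bs) (inj₂ p ∷ W) (inj₂ p ∷ W′)
  dup   : ∀ {bs W W′ p} → Expand bs (inj₂ p ∷ W) W′ → Expand (true ∷ bs) (inj₂ p ∷ W) (inj₂ p ∷ W′)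

-- The decoder returns the unread bits, so that one string serves all time steps in succession. The
-- value for a string that ends too early is an arbitrary default.
expand : ∀ {P} → List Bool → List (Container P) → List (Container P) × List Bool
expand bs           []           = [] , bs
expand bs           (inj₁ j ∷ W) = let W′ , cs = expand bs W in inj₁ j ∷ W′ , cs
expand []           (inj₂ p ∷ W) = [] , []
expand (false ∷ bs) (inj₂ p ∷ W) = let W′ , cs = expand bs W in inj₂ p ∷ W′ , cs
expand (true ∷ bs)  (inj₂ p ∷ W) = let W′ , cs = expand bs (inj₂ p ∷ W) in inj₂ p ∷ W′ , cs

loads : CoarseOp → ℕ → Bool
loads (wr i) j = i ≡ᵇ j
loads _      j = false

-- The first match wins because the head of the processor list is the outermost, hence last, write
-- in the `foldr` of `exec`.
holder : ∀ {P} → Vec CoarseOp P → List (Fin P) → ℕ → Container P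
holder os []       j = inj₁ j
holder os (p ∷ ps) j with loads (Vec.lookup os p) j
... | true  = inj₂ p
... | false = holder os ps j

-- Undoing a parallel I/O: letters of written blocks become processors, and each bit says whether
-- a cache letter was read from memory.
data Select {P} (os : Vec CoarseOp P) : List Bool → List (Container P) → List (Container P) → Set where
  []    : Select os [] [] []
  block : ∀ {bs W W′ j} → Select os bs W W′ → Select os bs (inj₁ j ∷ W) (holder os (allFin P) j ∷ W′)
  stay  : ∀ {bs W W′ p} → Select os bs W W′ → Select os (false ∷ bs) (inj₂ p ∷ W) (inj₂ p ∷ W′)
  move  : ∀ {bs W W′ p j} → Vec.lookup os p ≡ rd j → Select os bs W W′ → Select os (true ∷ bs) (inj₂ p ∷ W) (inj₁ j ∷ W′)

readBlock : ∀ {P} → Vec CoarseOp P → Fin P → Container P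
readBlock os p with Vec.lookup os p
... | rd j = inj₁ j
-- A default only: `move` carries a proof that the operation is a read.
... | _    = inj₂ p

select : ∀ {P} → Vec CoarseOp P → List Bool → List (Container P) → List (Container P) × List Bool
select os bs           []           = [] , bs
select os bs           (inj₁ j ∷ W) = let W′ , cs = select os bs W in holder os (allFin _) j ∷ W′ , cs
select os []           (inj₂ p ∷ W) = [] , []
select os (false ∷ bs) (inj₂ p ∷ W) = let W′ , cs = select os bs W in inj₂ p ∷ W′ , cs
select os (true ∷ bs)  (inj₂ p ∷ W) = let W′ , cs = select os bs W in readBlock os p ∷ W′ , cs

expand-complete : ∀ {P bs} {W W′ : List (Container P)} cs → Expand bs W W′ → expand (bs ++ cs) W ≡ (W′ , cs)
expand-complete cs []        = refl
expand-complete cs (block e) rewrite expand-complete cs e = refl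
expand-complete cs (keep e)  rewrite expand-complete cs e = refl
expand-complete cs (dup e)   rewrite expand-complete cs e = refl

select-complete : ∀ {P os bs} {W W′ : List (Container P)} cs → Select os bs W W′ → select os (bs ++ cs) W ≡ (W′ , cs)
select-complete cs []         = refl
select-complete cs (block s)  rewrite select-complete cs s = refl
select-complete cs (stay s)   rewrite select-complete cs s = refl
select-complete cs (move o s) rewrite select-complete cs s | o = refl

expand-refl : ∀ {P} (W : List (Container P)) → ∃ λ bs → Expand bs W W
expand-refl []           = [] , []
expand-refl (inj₁ _ ∷ W) = _ , block (proj₂ (expand-refl W))
expand-refl (inj₂ _ ∷ W) = _ , keep (proj₂ (expand-refl W))

-- Composition merges all local operations between two parallel I/Os into a single expansion, so
-- their number does not enter the count.
expand-trans : ∀ {P bs cs} {U V W : List (Container P)} → Expand bs U V → Expand cs V W → ∃ λ ds → Expand ds U W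
expand-trans []        []        = [] , []
expand-trans (block e) (block f) = _ , block (proj₂ (expand-trans e f))
expand-trans (keep e)  (keep f)  = _ , keep (proj₂ (expand-trans e f))
expand-trans (dup e)   (keep f)  = _ , dup (proj₂ (expand-trans e f))
expand-trans (keep e)  (dup f)   = _ , dup (proj₂ (expand-trans (keep e) f))
expand-trans (dup e)   (dup f)   = _ , dup (proj₂ (expand-trans (dup e) f))

expand-length : ∀ {P bs} {W W′ : List (Container P)} → Expand bs W W′ → length bs ≡ caches W′
expand-length []        = refl
expand-length (block e) = expand-length e
expand-length (keep e)  = cong suc (expand-length e)
expand-length (dup e)   = cong suc (expand-length e)

expand-ones : ∀ {P bs} {W W′ : List (Container P)} → Expand bs W W′ → ones bs + length W ≡ length W′
expand-ones []                     = refl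
expand-ones {bs = bs} (block {W = W} e) = trans (+-suc (ones bs) (length W)) (cong suc (expand-ones e))
expand-ones (keep {bs = bs} {W = W} e)  = trans (+-suc (ones bs) (length W)) (cong suc (expand-ones e))
expand-ones (dup e)                = cong suc (expand-ones e)

expand-blocks : ∀ {P bs} {W W′ : List (Container P)} → Expand bs W W′ → blocks W′ ≡ blocks W
expand-blocks []        = refl
expand-blocks (block e) = cong suc (expand-blocks e)
expand-blocks (keep e)  = expand-blocks e
expand-blocks (dup e)   = expand-blocks e

select-length : ∀ {P os bs} {W W′ : List (Container P)} → Select os bs W W′ → length bs ≡ caches W
select-length []         = refl
select-length (block s)  = select-length s
select-length (stay s)   = cong suc (select-length s)
select-length (move _ s) = cong suc (select-length s)

select-word-length : ∀ {P os bs} {W W′ : List (Container P)} → Select os bs W W′ → length W′ ≡ length W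
select-word-length []         = refl
select-word-length (block s)  = cong suc (select-word-length s)
select-word-length (stay s)   = cong suc (select-word-length s)
select-word-length (move _ s) = cong suc (select-word-length s)

blocks-∷ : ∀ {P} c (W : List (Container P)) → blocks (c ∷ W) ≤ suc (blocks W)
blocks-∷ (inj₁ _) W = ≤-refl
blocks-∷ (inj₂ _) W = n≤1+n _

select-blocks : ∀ {P os bs} {W W′ : List (Container P)} → Select os bs W W′ → blocks W′ ≤ blocks W + ones bs
select-blocks [] = z≤n
select-blocks {os = os} (block {W′ = W′} {j} s) = ≤-trans (blocks-∷ (holder os (allFin _) j) W′) (s≤s (select-blocks s))
select-blocks (stay s) = select-blocks s
select-blocks (move {W = W} _ s) = ≤-trans (s≤s (select-blocks s)) (≤-reflexive (sym (+-suc (blocks W) _)))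

-- D bounds the number of live cache cells at any time, Q the number of cells read in one parallel I/O.
data Trace {P} (D Q : ℕ) : ∀ {T} → Vec (Vec CoarseOp P) T → List Bool → List (Container P) → List (Container P) → Set where
  start : ∀ {bs W W′} → Expand bs W W′ → caches W′ ≤ D → Trace D Q [] bs W W′
  step  : ∀ {T} {oss : Vec _ T} {os as bs cs W V V′ W′} → Trace D Q oss as W V →
          Select os bs V V′ → ones bs ≤ Q → Expand cs V′ W′ → caches W′ ≤ D →
          Trace D Q (os ∷ oss) (as ++ bs ++ cs) W W′

-- The head of the vector is the earliest I/O and hence the last to be undone, which is why the tail
-- is replayed first.
replay : ∀ {P T} → Vec (Vec CoarseOp P) T → List Bool → List (Container P) → List (Container P) × List Bool
replay []         bs W = expand bs W
replay (os ∷ oss) bs W = let V , bs′ = replay oss bs W ; V′ , bs″ = select os bs′ V in expand bs″ V′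

module _ {P D Q : ℕ} where

  replay-complete : ∀ {T bs W W′} {oss : Vec (Vec CoarseOp P) T} ds → Trace D Q oss bs W W′ → replay oss (bs ++ ds) W ≡ (W′ , ds)
  replay-complete ds (start e _) = expand-complete ds e
  replay-complete ds (step {as = as} {bs} {cs} t s _ e _)
    rewrite ++-assoc as (bs ++ cs) ds | replay-complete ((bs ++ cs) ++ ds) t
          | ++-assoc bs cs ds | select-complete (cs ++ ds) s = expand-complete ds e

  trace-expand : ∀ {T bs cs W W′ W″} {oss : Vec (Vec CoarseOp P) T} → Trace D Q oss bs W W′ → Expand cs W′ W″ → caches W″ ≤ D →
                 ∃ λ ds → Trace D Q oss ds W W″
  trace-expand (start e _)      f W″≤D = _ , start (proj₂ (expand-trans e f)) W″≤D
  trace-expand (step t s q e _) f W″≤D = _ , step t s q (proj₂ (expand-trans e f)) W″≤D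

  trace-caches : ∀ {T bs W W′} {oss : Vec (Vec CoarseOp P) T} → Trace D Q oss bs W W′ → caches W′ ≤ D
  trace-caches (start _ W′≤D)      = W′≤D
  trace-caches (step _ _ _ _ W′≤D) = W′≤D

  -- There is one expansion after the last I/O, and one selection and one expansion for each I/O. A
  -- selection spends a bit per cache letter of its input and an expansion a bit per cache letter of
  -- its result, both at most `D`.
  trace-length : ∀ {T bs W W′} {oss : Vec (Vec CoarseOp P) T} → Trace D Q oss bs W W′ → length bs ≤ (1 + 2 * T) * D
  trace-length (start e W′≤D) = ≤-trans (≤-reflexive (expand-length e)) (≤-trans W′≤D (m≤m+n D 0))
  trace-length {suc T} (step {as = as} {bs} {cs} t s _ e W′≤D) = begin
    length (as ++ bs ++ cs)               ≡⟨ trans (length-++ as) (cong (length as +_) (length-++ bs)) ⟩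
    length as + (length bs + length cs)   ≤⟨ +-mono-≤ (trace-length t) (+-mono-≤ (≤-trans (≤-reflexive (select-length s)) (trace-caches t))
                                                                              (≤-trans (≤-reflexive (expand-length e)) W′≤D)) ⟩
    (1 + 2 * T) * D + (D + D)             ≡⟨ identity T D ⟩
    (1 + 2 * suc T) * D                   ∎
    where
    open ≤-Reasoning
    identity : ∀ T D → (1 + 2 * T) * D + (D + D) ≡ (1 + 2 * suc T) * D
    identity = solve-∀

  -- Each `true` bit of an expansion lengthens the word by one, and selections preserve its length;
  -- so the expansions have as many ones as letters were gained overall, and only selections need
  -- the bound `Q`.
  trace-ones : ∀ {T bs W W′} {oss : Vec (Vec CoarseOp P) T} → Trace D Q oss bs W W′ → ones bs + length W ≤ length W′ + T * Q
  trace-ones (start e _) = ≤-trans (≤-reflexive (expand-ones e)) (m≤m+n _ _)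
  trace-ones {suc T} {W = W} {W′} (step {as = as} {bs} {cs} {V = V} {V′} t s bs≤Q e _) = begin
    ones (as ++ bs ++ cs) + length W              ≡⟨ cong (_+ length W) (trans (ones-++ as _) (cong (ones as +_) (ones-++ bs cs))) ⟩
    ones as + (ones bs + ones cs) + length W      ≡⟨ left (ones as) (ones bs) (ones cs) (length W) ⟩
    ones as + length W + ones bs + ones cs        ≤⟨ +-monoˡ-≤ (ones cs) (+-mono-≤ (trace-ones t) bs≤Q) ⟩
    length V + T * Q + Q + ones cs                ≡⟨ cong (λ v → v + T * Q + Q + ones cs) (select-word-length s) ⟨
    length V′ + T * Q + Q + ones cs               ≡⟨ right (length V′) (T * Q) Q (ones cs) ⟩
    ones cs + length V′ + (Q + T * Q)             ≡⟨ cong (_+ (Q + T * Q)) (expand-ones e) ⟩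
    length W′ + suc T * Q                         ∎
    where
    open ≤-Reasoning
    left : ∀ a b c w → a + (b + c) + w ≡ a + w + b + c
    left = solve-∀
    right : ∀ v x q c → v + x + q + c ≡ c + v + (q + x)
    right = solve-∀

  -- A block letter can be created only by a `true` bit of a selection. As all inputs start in
  -- memory, this forces enough I/Os to bring every input into a cache.
  trace-blocks : ∀ {T bs W W′} {oss : Vec (Vec CoarseOp P) T} → Trace D Q oss bs W W′ → blocks W′ ≤ blocks W + T * Q
  trace-blocks (start e _) = ≤-trans (≤-reflexive (expand-blocks e)) (m≤m+n _ _)
  trace-blocks {suc T} {W = W} {W′} (step {bs = bs} {V = V} {V′} t s bs≤Q e _) = begin
    blocks W′               ≡⟨ expand-blocks e ⟩
    blocks V′               ≤⟨ select-blocks s ⟩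
    blocks V + ones bs      ≤⟨ +-mono-≤ (trace-blocks t) bs≤Q ⟩
    blocks W + T * Q + Q    ≡⟨ identity (blocks W) (T * Q) Q ⟩
    blocks W + (Q + T * Q)  ∎
    where
    open ≤-Reasoning
    identity : ∀ w x q → w + x + q ≡ w + (q + x)
    identity = solve-∀

-- The finite list of words reachable by cheap traces.

coarseOps : ℕ → List CoarseOp
coarseOps K = idle ∷ map rd (upTo K) ++ map wr (upTo K)

data Below (K : ℕ) : CoarseOp → Set where
  idle : Below K idle
  rd   : ∀ {j} → j < K → Below K (rd j)
  wr   : ∀ {j} → j < K → Below K (wr j)

∈-coarseOps : ∀ {K o} → Below K o → o ∈ coarseOps K
∈-coarseOps idle                = here refl
∈-coarseOps (rd j<K)            = there (∈-++⁺ˡ (∈-map⁺ rd (∈-upTo⁺ j<K)))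
∈-coarseOps {K} (wr j<K)        = there (∈-++⁺ʳ (map rd (upTo K)) (∈-map⁺ wr (∈-upTo⁺ j<K)))

length-coarseOps : ∀ K → length (coarseOps K) ≡ suc (K + K)
length-coarseOps K = cong suc (trans (length-++ (map rd (upTo K)))
  (cong₂ _+_ (trans (length-map rd (upTo K)) (length-upTo K)) (trans (length-map wr (upTo K)) (length-upTo K))))

candidates : (N P B d T : ℕ) → List (List (Container P))
candidates N P B d T = cartesianProductWith (λ (j , oss) bs → proj₁ (replay oss bs (inj₁ j ∷ [])))
  (cartesianProductWith _,_ (upTo (2 * N)) (vectors (vectors (coarseOps (2 * N)) P) T))
  (bitStrings (suc d * (3 * (T * P * B))) (3 * (T * P * B)))

length-candidates : ∀ N .{{_ : NonZero N}} P B d T → length (candidates N P B d T) ≤ traceCount N P B d T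
length-candidates N P B d T = begin
  length (candidates N P B d T)
    ≡⟨ length-cartesianProductWith _ (cartesianProductWith _,_ (upTo (2 * N)) (vectors (vectors os P) T)) _ ⟩
  length (cartesianProductWith _,_ (upTo (2 * N)) (vectors (vectors os P) T)) * c
    ≡⟨ cong (_* c) (length-cartesianProductWith _,_ (upTo (2 * N)) (vectors (vectors os P) T)) ⟩
  length (upTo (2 * N)) * length (vectors (vectors os P) T) * c
    ≡⟨ cong₂ (λ x y → x * y * c) (length-upTo (2 * N)) (trans (length-vectors (vectors os P) T) (cong (_^ T) (length-vectors os P))) ⟩
  2 * N * (length os ^ P) ^ T * c
    ≤⟨ *-monoˡ-≤ c (*-monoʳ-≤ (2 * N) (^-monoˡ-≤ T (^-monoˡ-≤ P os≤))) ⟩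
  2 * N * ((5 * N) ^ P) ^ T * c ∎
  where
  open ≤-Reasoning
  os = coarseOps (2 * N)
  c = length (bitStrings (suc d * (3 * (T * P * B))) (3 * (T * P * B)))
  identity : ∀ N → N + (2 * N + 2 * N) ≡ 5 * N
  identity = solve-∀
  os≤ : length os ≤ 5 * N
  os≤ = begin
    length os               ≡⟨ length-coarseOps (2 * N) ⟩
    1 + (2 * N + 2 * N)     ≤⟨ +-monoˡ-≤ _ (>-nonZero⁻¹ N) ⟩
    N + (2 * N + 2 * N)     ≡⟨ identity N ⟩
    5 * N                   ∎

-- `bitStrings` has strings of one fixed length, so the bits are padded with `false`, which adds no
-- ones and which `replay` leaves unread. The condition `1 ≤ T` rounds the `1 + 2 * T` groups of
-- bits up to `3 * T`.
trace∈candidates : ∀ {N P B d T j bs W} {oss : Vec (Vec CoarseOp P) T} → N ≤ 2 * (T * P * B) → 1 ≤ T →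
                   j < 2 * N → VecAll.All (VecAll.All (Below (2 * N))) oss → length W ≡ N →
                   Trace (suc d * (P * B)) (P * B) oss bs (inj₁ j ∷ []) W → W ∈ candidates N P B d T
trace∈candidates {N} {P} {B} {d} {T} {j} {bs} {W} {oss} N≤2E 1≤T j<K oss<K W≡N t =
  subst (_∈ candidates N P B d T) (cong proj₁ (replay-complete padding t))
    (∈-cartesianProductWith⁺ (λ (j , oss) bs → proj₁ (replay oss bs (inj₁ j ∷ [])))
      (∈-cartesianProductWith⁺ _,_ (∈-upTo⁺ j<K) (∈-vectors (VecAll.map (λ os → ∈-vectors (VecAll.map ∈-coarseOps os)) oss<K)))
      (∈-bitStrings (bs ++ padding) padded-length padded-ones))
  where
  open ≤-Reasoning
  E = T * P * B
  zeros : ℕ → List Bool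
  zeros zero    = []
  zeros (suc n) = false ∷ zeros n
  length-zeros : ∀ n → length (zeros n) ≡ n
  length-zeros zero    = refl
  length-zeros (suc n) = cong suc (length-zeros n)
  ones-zeros : ∀ n → ones (zeros n) ≡ 0
  ones-zeros zero    = refl
  ones-zeros (suc n) = ones-zeros n
  padding = zeros (suc d * (3 * E) ∸ length bs)
  identity : ∀ T d P B → (T + 2 * T) * (suc d * (P * B)) ≡ suc d * (3 * (T * P * B))
  identity = solve-∀
  bs≤ : length bs ≤ suc d * (3 * E)
  bs≤ = begin
    length bs                              ≤⟨ trace-length t ⟩
    (1 + 2 * T) * (suc d * (P * B))        ≤⟨ *-monoˡ-≤ (suc d * (P * B)) (+-monoˡ-≤ (2 * T) 1≤T) ⟩
    (T + 2 * T) * (suc d * (P * B))        ≡⟨ identity T d P B ⟩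
    suc d * (3 * E)                        ∎
  padded-length : length (bs ++ padding) ≡ suc d * (3 * E)
  padded-length = trans (length-++ bs) (trans (cong (length bs +_) (length-zeros _)) (m+[n∸m]≡n bs≤))
  identity′ : ∀ E → 2 * E + E ≡ 3 * E
  identity′ = solve-∀
  padded-ones : ones (bs ++ padding) ≤ 3 * E
  padded-ones = begin
    ones (bs ++ padding)          ≡⟨ ones-++ bs padding ⟩
    ones bs + ones padding        ≡⟨ cong (ones bs +_) (ones-zeros (suc d * (3 * E) ∸ length bs)) ⟩
    ones bs + 0                   ≤⟨ +-monoʳ-≤ (ones bs) z≤n ⟩
    -- The `1` is the length of the word at which the trace starts, the single letter of the output
    -- cell.
    ones bs + 1                   ≤⟨ trace-ones t ⟩
    length W + T * (P * B)        ≡⟨ cong₂ _+_ W≡N (sym (*-assoc T P B)) ⟩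
    N + E                         ≤⟨ +-monoˡ-≤ E N≤2E ⟩
    2 * E + E                     ≡⟨ identity′ E ⟩
    3 * E                         ∎

-- Live locations of the machine and the words they spell.

word : ∀ {N} → Term N → List (Fin N)
word {N} = eval (++-semigroup (Fin N)) [_]

first : ∀ {N} (t : Term N) → ∃ (_∈ word t)
first (leaf i) = i , here refl
first (t ⊗ _)  = let i , i∈ = first t in i , ∈-++⁺ˡ i∈

0<length-word : ∀ {N} (t : Term N) → 0 < length (word t)
0<length-word t with word t | first t
... | _ ∷ _ | _ = s≤s z≤n

Unique-++⁻ʳ : {A : Set} (xs : List A) {ys : List A} → Unique (xs ++ ys) → Unique ys
Unique-++⁻ʳ []       u       = u
Unique-++⁻ʳ (_ ∷ xs) (_ ∷ u) = Unique-++⁻ʳ xs u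

Unique-++-disjoint : {A : Set} (xs : List A) {ys : List A} {x : A} → Unique (xs ++ ys) → x ∈ xs → x ∉ ys
Unique-++-disjoint (_ ∷ xs) (x∉ ∷ _) (here refl) x∈ys = All.lookup x∉ (∈-++⁺ʳ xs x∈ys) refl
Unique-++-disjoint (_ ∷ xs) (_ ∷ u)  (there x∈)  x∈ys = Unique-++-disjoint xs u x∈ x∈ys

module _ {B : ℕ} .{{_ : NonZero B}} where

  block-of : ∀ j (k : Fin B) → (j * B + toℕ k) / B ≡ j
  block-of j k = trans (+-distrib-/-∣ˡ (toℕ k) (n∣m*n j))
    (trans (cong₂ _+_ (m*n/n≡m j B) (m<n⇒m/n≡0 (toℕ<n k))) (+-identityʳ j))

  offset-of : ∀ j (k : Fin B) → (j * B + toℕ k) mod B ≡ k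
  offset-of j k = toℕ-injective (trans (toℕ-fromℕ< _)
    (trans (cong (_% B) (+-comm (j * B) (toℕ k))) (trans ([m+kn]%n≡m%n (toℕ k) j B) (m<n⇒m%n≡m (toℕ<n k)))))

  block-offset : ∀ a → a / B * B + toℕ (a mod B) ≡ a
  block-offset a = trans (cong (a / B * B +_) (toℕ-fromℕ< _)) (trans (+-comm _ (a % B)) (sym (m≡m%n+[m/n]*n a B)))

module Machine {N P M B : ℕ} .{{_ : NonZero B}} where

  Location : Set
  Location = ℕ ⊎ (Fin P × Fin M)

  content : State N P M → Location → Maybe (Term N)
  content st (inj₁ a)       = mem st a
  content st (inj₂ (p , s)) = cache st p s

  -- The invariant of the backward trace. Cells outside the list may hold anything, since they no
  -- longer influence the output.
  data Spells (st : State N P M) : List Location → List (Fin N) → Set where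
    []   : Spells st [] []
    cons : ∀ {ℓ t L w} → content st ℓ ≡ just t → Spells st L w → Spells st (ℓ ∷ L) (word t ++ w)

  spelled : ∀ {st L w ℓ t i} → Spells st L w → ℓ ∈ L → content st ℓ ≡ just t → i ∈ word t → i ∈ w
  spelled (cons eq sp) (here refl) eq′ i∈ with refl ← just-injective (trans (sym eq) eq′) = ∈-++⁺ˡ i∈
  spelled (cons {t = t} _ sp) (there ℓ∈) eq′ i∈ = ∈-++⁺ʳ (word t) (spelled sp ℓ∈ eq′ i∈)

  -- Every atom denotes a nonempty word, so a repeated location would repeat an input.
  spells-unique : ∀ {st L w} → Spells st L w → Unique w → Unique L
  spells-unique [] _ = []
  spells-unique (cons {t = t} eq sp) u =
    All.tabulate (λ { ℓ∈L refl → let i , i∈ = first t in Unique-++-disjoint (word t) u i∈ (spelled sp ℓ∈L eq i∈) })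
    ∷ spells-unique sp (Unique-++⁻ʳ (word t) u)

  spells-length : ∀ {st L w} → Spells st L w → length L ≤ length w
  spells-length [] = z≤n
  spells-length (cons {t = t} {w = w} _ sp) =
    ≤-trans (+-mono-≤ (0<length-word t) (spells-length sp)) (≤-reflexive (sym (length-++ (word t))))

  spells-map : ∀ {st st′} (f : Location → Location) → (∀ ℓ → content st′ ℓ ≡ content st (f ℓ)) →
               ∀ {L w} → Spells st′ L w → Spells st (map f L) w
  spells-map f same []            = []
  spells-map f same (cons {ℓ} eq sp) = cons (trans (sym (same ℓ)) eq) (spells-map f same sp)

  local-origin : ∀ (op : LocalOp M) (c : Fin M → Maybe (Term N)) s {t} → applyLocal op c s ≡ just t →
                 (∃ λ u → c u ≡ just t) ⊎ (∃₂ λ u v → ∃₂ λ x y → c u ≡ just x × c v ≡ just y × t ≡ x ⊗ y)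
  local-origin (copy u d) c s eq with s F.≟ d
  ... | yes _ = inj₁ (u , eq)
  ... | no  _ = inj₁ (s , eq)
  local-origin (delete d) c s eq with s F.≟ d
  ... | no  _ = inj₁ (s , eq)
  local-origin (combine u v d) c s eq with c u in equ | c v in eqv
  ... | nothing | _       = inj₁ (s , eq)
  ... | just _  | nothing = inj₁ (s , eq)
  ... | just x  | just y  with s F.≟ d
  ...   | yes _ = inj₂ (u , v , x , y , equ , eqv , sym (just-injective eq))
  ...   | no  _ = inj₁ (s , eq)

  readFrom : Maybe (IOOp M B) → Fin M → Maybe (ℕ × Fin B)
  readFrom (just (read j r)) s = Maybe.map (j ,_) (r s)
  readFrom _                 s = nothing

  writtenFrom : Maybe (IOOp M B) → ℕ → Maybe (Fin M)
  writtenFrom (just (write j w)) a with a / B ≟ j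
  ... | yes _ = just (w (a mod B))
  ... | no  _ = nothing
  writtenFrom _ a = nothing

  ioCache-content : ∀ (m : ℕ → Maybe (Term N)) o c s →
                    ioCache m o c s ≡ maybe′ (λ (j , k) → m (j * B + toℕ k)) (c s) (readFrom o s)
  ioCache-content m nothing            c s = refl
  ioCache-content m (just (write _ _)) c s = refl
  ioCache-content m (just (read j r))  c s with r s
  ... | just _  = refl
  ... | nothing = refl

  ioMem-content : ∀ (m : ℕ → Maybe (Term N)) o c a → ioMem c o m a ≡ maybe′ c (m a) (writtenFrom o a)
  ioMem-content m nothing            c a = refl
  ioMem-content m (just (read _ _))  c a = refl
  ioMem-content m (just (write j w)) c a with a / B ≟ j
  ... | yes a∈j = hit (allFin B) (∈-allFin (a mod B))
    where
    hit : ∀ ks → a mod B ∈ ks → foldr (λ k m → updateℕ m (j * B + toℕ k) (c (w k))) m ks a ≡ c (w (a mod B))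
    hit (k ∷ ks) k∈ with a ≡ᵇ j * B + toℕ k in eq
    ... | true  = cong (λ k → c (w k)) (trans (sym (offset-of j k)) (cong (_mod B) (sym (≡ᵇ⇒≡ a _ (subst Bool.T (sym eq) tt)))))
    hit (k ∷ ks) (there k∈)  | false = hit ks k∈
    hit (k ∷ ks) (here refl) | false =
      ⊥-elim (subst Bool.T eq (≡⇒≡ᵇ a _ (trans (sym (block-offset a)) (cong (λ i → i * B + toℕ k) a∈j))))
  ... | no a∉j = miss (allFin B)
    where
    miss : ∀ ks → foldr (λ k m → updateℕ m (j * B + toℕ k) (c (w k))) m ks a ≡ m a
    miss []       = refl
    miss (k ∷ ks) with a ≡ᵇ j * B + toℕ k in eq
    ... | true  = contradiction (trans (cong (_/ B) (≡ᵇ⇒≡ a _ (subst Bool.T (sym eq) tt))) (block-of j k)) a∉j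
    ... | false = miss ks

  module _ (ops : Fin P → Maybe (IOOp M B)) where

    memSource : List (Fin P) → ℕ → Location
    memSource []       a = inj₁ a
    memSource (p ∷ ps) a = maybe′ (λ s → inj₂ (p , s)) (memSource ps a) (writtenFrom (ops p) a)

    -- After a parallel I/O every cell holds a copy of one earlier cell, so undoing it is a map on
    -- locations that leaves the spelled word unchanged.
    source : Location → Location
    source (inj₁ a)       = memSource (allFin P) a
    source (inj₂ (p , s)) = maybe′ (λ (j , k) → inj₁ (j * B + toℕ k)) (inj₂ (p , s)) (readFrom (ops p) s)

    content-source : ∀ st ℓ → content (exec (parIO ops) st) ℓ ≡ content st (source ℓ)
    content-source st (inj₁ a) = go (allFin P)
      where
      go : ∀ ps → foldr (λ p m → ioMem (cache st p) (ops p) m) (mem st) ps a ≡ content st (memSource ps a)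
      go []       = refl
      go (p ∷ ps) = trans (ioMem-content _ (ops p) (cache st p) a) (pick (writtenFrom (ops p) a))
        where
        pick : ∀ o → maybe′ (cache st p) (foldr (λ p m → ioMem (cache st p) (ops p) m) (mem st) ps a) o ≡
               content st (maybe′ (λ s → inj₂ (p , s)) (memSource ps a) o)
        pick (just s) = refl
        pick nothing  = go ps
    content-source st (inj₂ (p , s)) = trans (ioCache-content (mem st) (ops p) (cache st p) s) (pick (readFrom (ops p) s))
      where
      pick : ∀ o → maybe′ (λ (j , k) → mem st (j * B + toℕ k)) (cache st p s) o ≡
             content st (maybe′ (λ (j , k) → inj₁ (j * B + toℕ k)) (inj₂ (p , s)) o)
      pick (just _) = refl
      pick nothing  = refl

    -- A processor reads only one block per I/O, so processor and offset determine the memory cell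
    -- that was read. This is where `P * B` enters as the bound on live letters read at once.
    slot : Location → Maybe (Fin (P * B))
    slot (inj₁ _)       = nothing
    slot (inj₂ (p , s)) = Maybe.map (λ (_ , k) → F.combine p k) (readFrom (ops p) s)

    slot-source : ∀ {ℓ ℓ′ i} → slot ℓ ≡ just i → slot ℓ′ ≡ just i → source ℓ ≡ source ℓ′
    slot-source {inj₂ (p , s)} {inj₂ (q , t)} eq eq′ with readFrom (ops p) s in r | readFrom (ops q) t in r′
    ... | just (j , k) | just (j′ , k′)
      with combine-injective p k q k′ (just-injective (trans eq (sym eq′)))
    ... | refl , refl = cong (λ j → inj₁ (j * B + toℕ k)) (same (ops p) r r′)
      where
      same : ∀ o {s t j j′ k k′} → readFrom o s ≡ just (j , k) → readFrom o t ≡ just (j′ , k′) → j ≡ j′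
      same (just (read j r)) {s} {t} e e′ with r s | r t
      same (just (read j r)) refl refl | just _ | just _ = refl

  writtenBlock : Maybe (IOOp M B) → Maybe ℕ
  writtenBlock (just (write j _)) = just j
  writtenBlock _                  = nothing

  writtenBlocks : List (Step P M B) → List ℕ
  writtenBlocks []               = []
  writtenBlocks (local _ _ ∷ xs) = writtenBlocks xs
  writtenBlocks (parIO ops ∷ xs) = mapMaybe (λ p → writtenBlock (ops p)) (allFin P) ++ writtenBlocks xs

  length-writtenBlocks : ∀ xs → length (writtenBlocks xs) ≤ cost xs * P
  length-writtenBlocks []               = z≤n
  length-writtenBlocks (local _ _ ∷ xs) = length-writtenBlocks xs
  length-writtenBlocks (parIO ops ∷ xs) = ≤-trans (≤-reflexive (length-++ (mapMaybe (λ p → writtenBlock (ops p)) (allFin P))))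
    (+-mono-≤ (≤-trans (length-mapMaybe (λ p → writtenBlock (ops p)) (allFin P)) (≤-reflexive (length-tabulate (λ p → p))))
              (length-writtenBlocks xs))

  ∈-writtenBlocks : ∀ ops p {j xs} → writtenBlock (ops p) ≡ just j → j ∈ writtenBlocks (parIO ops ∷ xs)
  ∈-writtenBlocks ops p {j} eq = ∈-++⁺ˡ (go (allFin P) (∈-allFin p))
    where
    go : ∀ ps → p ∈ ps → j ∈ mapMaybe (λ p → writtenBlock (ops p)) ps
    go (q ∷ ps) (here refl) rewrite eq = here refl
    go (q ∷ ps) (there p∈) with writtenBlock (ops q)
    ... | just _  = there (go ps p∈)
    ... | nothing = go ps p∈

  module Naming (ρ : ℕ → ℕ) where

    container : Location → Container P
    container (inj₁ a)       = inj₁ (ρ (a / B))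
    container (inj₂ (p , _)) = inj₂ p

    spells-local : ∀ q op st {L w} → Spells (exec {B = B} (local q op) st) L w →
                   ∃₂ λ L′ bs → Spells st L′ w × Expand bs (map container L) (map container L′)
    spells-local q op st [] = [] , [] , [] , []
    spells-local q op st (cons {inj₁ a} eq sp) =
      let L′ , _ , sp′ , e = spells-local q op st sp in inj₁ a ∷ L′ , _ , cons eq sp′ , block e
    spells-local q op st (cons {inj₂ (p , s)} {w = w} eq sp) with p F.≟ q | spells-local q op st sp
    ... | no _     | L′ , _ , sp′ , e = inj₂ (p , s) ∷ L′ , _ , cons eq sp′ , keep e
    ... | yes refl | L′ , _ , sp′ , e with local-origin op (cache st p) s eq
    ...   | inj₁ (u , eq′) = inj₂ (p , u) ∷ L′ , _ , cons eq′ sp′ , keep e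
    ...   | inj₂ (u , v , x , y , equ , eqv , refl) =
      inj₂ (p , u) ∷ inj₂ (p , v) ∷ L′ , _ ,
      subst (Spells st _) (sym (++-assoc (word x) (word y) w)) (cons equ (cons eqv sp′)) , dup (keep e)

    coarse : Maybe (IOOp M B) → CoarseOp
    coarse (just (read j _))  = rd (ρ j)
    coarse (just (write j _)) = wr (ρ j)
    coarse nothing            = idle

    coarse-readFrom : ∀ o s {j k} → readFrom o s ≡ just (j , k) → coarse o ≡ rd (ρ j)
    coarse-readFrom (just (read j r)) s eq with r s
    coarse-readFrom (just (read j r)) s refl | just _ = refl

    -- Names may collide in general, but a written block must be recognisable: `holder` decides by
    -- name alone which letters return to a processor.
    Separated : ℕ → Set
    Separated j = ∀ i → ρ j ≡ ρ i → j ≡ i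

    coarse-writtenFrom : ∀ o → (∀ j → writtenBlock o ≡ just j → Separated j) → ∀ a →
                         loads (coarse o) (ρ (a / B)) ≡ Maybe.is-just (writtenFrom o a)
    coarse-writtenFrom nothing            sep a = refl
    coarse-writtenFrom (just (read _ _))  sep a = refl
    coarse-writtenFrom (just (write j w)) sep a with a / B ≟ j
    ... | yes refl with ρ (a / B) ≡ᵇ ρ (a / B) in eq
    ...   | true  = refl
    ...   | false = ⊥-elim (subst Bool.T eq (≡⇒≡ᵇ (ρ (a / B)) _ refl))
    coarse-writtenFrom (just (write j w)) sep a | no a∉j with ρ j ≡ᵇ ρ (a / B) in eq
    ...   | true  = contradiction (sym (sep j refl (a / B) (≡ᵇ⇒≡ (ρ j) _ (subst Bool.T (sym eq) tt)))) a∉j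
    ...   | false = refl

    module _ (ops : Fin P → Maybe (IOOp M B)) (sep : ∀ p j → writtenBlock (ops p) ≡ just j → Separated j) where

      private
        os : Vec CoarseOp P
        os = Vec.tabulate (λ p → coarse (ops p))

      container-memSource : ∀ ps a → container (memSource ops ps a) ≡ holder os ps (ρ (a / B))
      container-memSource []       a = refl
      container-memSource (p ∷ ps) a
        rewrite lookup∘tabulate (λ p → coarse (ops p)) p | coarse-writtenFrom (ops p) (sep p) a
        with writtenFrom (ops p) a
      ... | just _  = refl
      ... | nothing = container-memSource ps a

      select-source : ∀ L → ∃ λ bs → Select os bs (map container L) (map container (map (source ops) L)) ×
                                     ones bs ≡ length (mapMaybe (slot ops) L)
      select-source [] = [] , [] , refl
      select-source (inj₁ a ∷ L) with select-source L
      ... | bs , s , eq = bs , subst (λ c → Select os bs _ (c ∷ _)) (sym (container-memSource (allFin P) a)) (block s) , eq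
      select-source (inj₂ (p , s) ∷ L) with select-source L | readFrom (ops p) s in r
      ... | bs , sel , eq | nothing      = false ∷ bs , stay sel , eq
      ... | bs , sel , eq | just (j , k) = true ∷ bs ,
        subst (λ i → Select os (true ∷ bs) _ (inj₁ (ρ i) ∷ _)) (sym (block-of j k))
          (move (trans (lookup∘tabulate (λ p → coarse (ops p)) p) (coarse-readFrom (ops p) s r)) sel) , cong suc eq

    cacheIndex : Location → Maybe (Fin (P * M))
    cacheIndex (inj₁ _)       = nothing
    cacheIndex (inj₂ (p , s)) = just (F.combine p s)

    length-cacheIndex : ∀ L → caches (map container L) ≡ length (mapMaybe cacheIndex L)
    length-cacheIndex []           = refl
    length-cacheIndex (inj₁ _ ∷ L) = length-cacheIndex L
    length-cacheIndex (inj₂ _ ∷ L) = cong suc (length-cacheIndex L)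

    module _ {K D} (ρ<K : ∀ j → ρ j < K) (capacity : ∀ c → c ≤ P * M → c ≤ N → c ≤ D) where

      -- Live cache cells are distinct, which gives `P * M`, and belong to a list of length at most
      -- `N`; `capacity` combines the two.
      caches-bound : ∀ {L} → Unique L → length L ≤ N → caches (map container L) ≤ D
      caches-bound {L} u L≤N rewrite length-cacheIndex L = capacity _
        (length-mapMaybe-≤ cacheIndex (λ ℓ → ℓ) injective L (subst Unique (sym (map-id L)) u))
        (≤-trans (length-mapMaybe cacheIndex L) L≤N)
        where
        injective : ∀ {ℓ ℓ′ i} → cacheIndex ℓ ≡ just i → cacheIndex ℓ′ ≡ just i → ℓ ≡ ℓ′
        injective {inj₂ (p , s)} {inj₂ (q , t)} eq eq′
          with combine-injective p s q t (just-injective (trans eq (sym eq′)))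
        ... | refl , refl = refl

      below : ∀ o → Below K (coarse o)
      below nothing            = idle
      below (just (read j _))  = rd (ρ<K j)
      below (just (write j _)) = wr (ρ<K j)

      spells-caches : ∀ {st L w} → Spells st L w → Unique w → length w ≤ N → caches (map container L) ≤ D
      spells-caches sp u w≤N = caches-bound (spells-unique sp u) (≤-trans (spells-length sp) w≤N)

      program-trace : ∀ xs st {L w} → (∀ {j} → j ∈ writtenBlocks xs → Separated j) → Unique w → length w ≤ N →
                      Spells (run xs st) L w →
                      ∃ λ (oss : Vec (Vec CoarseOp P) (cost xs)) → ∃₂ λ bs L₀ → Spells st L₀ w ×
                        Trace D (P * B) oss bs (map container L) (map container L₀) × VecAll.All (VecAll.All (Below K)) oss
      program-trace [] st {L} sep u w≤N sp =
        [] , _ , L , sp , start (proj₂ (expand-refl (map container L))) (spells-caches sp u w≤N) , []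
      program-trace (local q op ∷ xs) st sep u w≤N sp with program-trace xs _ sep u w≤N sp
      ... | oss , bs , L₁ , sp₁ , t , oss<K with spells-local q op st sp₁
      ...   | L₀ , cs , sp₀ , e = oss , _ , L₀ , sp₀ , proj₂ (trace-expand t e (spells-caches sp₀ u w≤N)) , oss<K
      program-trace (parIO ops ∷ xs) st sep u w≤N sp
        with program-trace xs _ (λ j∈ → sep (∈-++⁺ʳ (mapMaybe (λ p → writtenBlock (ops p)) (allFin P)) j∈)) u w≤N sp
      ... | oss , bs , L₁ , sp₁ , t , oss<K with select-source ops (λ p j eq → sep (∈-writtenBlocks ops p {xs = xs} eq)) L₁
      ...   | cs , s , ones≡ = _ , _ , map (source ops) L₁ , sp₀ ,
        -- The sources are the live list before the I/O, hence distinct, so the slot count applies.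
        -- The step gets a trivial expansion, which earlier local operations extend.
        step t s (≤-trans (≤-reflexive ones≡) (length-mapMaybe-≤ (slot ops) (source ops) (λ {ℓ} {ℓ′} → slot-source ops {ℓ} {ℓ′}) L₁ (spells-unique sp₀ u)))
             (proj₂ (expand-refl _)) (spells-caches sp₀ u w≤N) ,
        VecAllP.tabulate⁺ (λ p → below (ops p)) ∷ oss<K
        where sp₀ = spells-map (source ops) (content-source ops st) sp₁

-- Compressing block names.

-- An absent index gets `length js`, a value taken by no member of the list.
position : List ℕ → ℕ → ℕ
position []       i = 0
position (j ∷ js) i with j ≟ i
... | yes _ = 0
... | no  _ = suc (position js i)

position-≤ : ∀ js i → position js i ≤ length js
position-≤ []       i = z≤n
position-≤ (j ∷ js) i with j ≟ i
... | yes _ = z≤n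
... | no  _ = s≤s (position-≤ js i)

position-injective : ∀ {js j} → j ∈ js → ∀ i → position js j ≡ position js i → j ≡ i
position-injective {k ∷ js} {j} j∈ i eq with k ≟ j | k ≟ i
... | yes refl | yes refl = refl
position-injective (here refl) i eq | no k≢j | _    = contradiction refl k≢j
position-injective (there j∈)  i eq | no _   | no _ = position-injective j∈ i (suc-injective eq)

-- Input blocks keep their index; all other blocks are numbered after them, by position in js.
rename : ℕ → List ℕ → ℕ → ℕ
rename N js j with j <? N
... | yes _ = j
... | no  _ = N + position js j

rename-< : ∀ {N j} js → j < N → rename N js j ≡ j
rename-< {N} {j} js j<N with j <? N
... | yes _  = refl
... | no j≮N = contradiction j<N j≮N

rename-bound : ∀ {N js} → length js < N → ∀ j → rename N js j < 2 * N
rename-bound {N} {js} js<N j with j <? N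
... | yes j<N = ≤-trans j<N (m≤m+n N _)
... | no  _   = ≤-trans (+-monoʳ-< N (≤-<-trans (position-≤ js j) js<N)) (≤-reflexive (cong (N +_) (sym (+-identityʳ N))))

-- With `js` the written blocks this yields `Separated`. It must fail for general `j`: all blocks
-- that are at least `N` and not in `js` share the name `N + length js`.
rename-injective : ∀ {N js j} → j ∈ js → ∀ i → rename N js j ≡ rename N js i → j ≡ i
rename-injective {N} {js} {j} j∈ i eq with j <? N | i <? N
... | yes _   | yes _   = eq
... | yes j<N | no  _   = contradiction (≤-trans (m≤m+n N _) (≤-reflexive (sym eq))) (<⇒≱ j<N)
... | no  _   | yes i<N = contradiction (≤-trans (m≤m+n N _) (≤-reflexive eq)) (<⇒≱ i<N)
... | no  _   | no  _   = position-injective j∈ i (+-cancelˡ-≡ N _ _ eq)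

-- From a correct program to a candidate word.

prod-singletons : ∀ {A : Set} {n} (f : Fin (suc n) → A) → prod (++-semigroup A) (λ i → [ f i ]) ≡ tabulate f
prod-singletons {n = zero}  f = refl
prod-singletons {n = suc n} f = cong (f zero ∷_) (prod-singletons (λ i → f (suc i)))

blocks-map-inj₁ : ∀ {P} {A : Set} (f : A → ℕ) xs → blocks {P} (map (λ x → inj₁ (f x)) xs) ≡ length xs
blocks-map-inj₁ f []       = refl
blocks-map-inj₁ f (_ ∷ xs) = cong suc (blocks-map-inj₁ f xs)

module _ {N P M B : ℕ} .{{_ : NonZero B}} where
  open Machine {N} {P} {M} {B}

  initial-content : ∀ ℓ {t} → content (initial N P M) ℓ ≡ just t → ∃ λ i → ℓ ≡ inj₁ (toℕ i) × t ≡ leaf i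
  initial-content (inj₁ a) eq with a <? N
  ... | yes a<N = fromℕ< a<N , cong inj₁ (sym (toℕ-fromℕ< a<N)) , sym (just-injective eq)

  spells-initial : ∀ ρ → (∀ j → j < N → ρ j ≡ j) → ∀ {L w} → Spells (initial N P M) L w →
                   map (Naming.container ρ) L ≡ map (λ i → inj₁ (toℕ i / B)) w
  spells-initial ρ ρ≡ [] = refl
  spells-initial ρ ρ≡ (cons {ℓ} eq sp) with initial-content ℓ eq
  ... | i , refl , refl = cong₂ _∷_ (cong inj₁ (ρ≡ _ (≤-<-trans (m/n≤m (toℕ i) B) (toℕ<n i)))) (spells-initial ρ ρ≡ sp)

inputWord : ∀ {N} P B .{{_ : NonZero B}} → List (Fin N) → List (Container P)
inputWord P B = map (λ i → inj₁ (toℕ i / B))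

correct⇒candidate : ∀ {N P M B d} .{{_ : NonZero B}} {π : Permutation′ N} (prog : Program P M B) → Correct N P M B π prog →
                    (∀ c → c ≤ P * M → c ≤ N → c ≤ suc d * (P * B)) → 2 ≤ N →
                    let T = cost (steps prog) in T * P < N →
                    N ≤ 2 * (T * P * B) × inputWord P B (tabulate (π ⟨$⟩ʳ_)) ∈ candidates N P B d T
correct⇒candidate {N@(suc n)} {P} {M} {B} {d} {π} prog (t , out≡t , t-correct) capacity 2≤N TP<N =
  N≤2E , trace∈candidates {B = B} {d} N≤2E 1≤T (ρ<2N (output prog / B)) oss<K
           (trans (length-map _ w) w-length) (subst (Trace _ _ oss bs (container (inj₁ (output prog)) ∷ [])) W≡ tr)
  where
  open Machine {N} {P} {M} {B}
  open ≤-Reasoning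
  T = cost (steps prog)
  E = T * P * B
  w = tabulate (π ⟨$⟩ʳ_)
  w-length : length w ≡ N
  w-length = length-tabulate (π ⟨$⟩ʳ_)
  w-unique : Unique w
  w-unique = tabulate⁺ (λ {i} {j} eq → trans (sym (inverseˡ π)) (trans (cong (π ⟨$⟩ˡ_) eq) (inverseˡ π)))
  word≡w : word t ++ [] ≡ w
  word≡w = trans (++-identityʳ (word t)) (trans (t-correct (++-semigroup (Fin N)) [_]) (prod-singletons (π ⟨$⟩ʳ_)))
  js = writtenBlocks (steps prog)
  ρ = rename N js
  open Naming ρ
  ρ<2N : ∀ j → ρ j < 2 * N
  ρ<2N = rename-bound {N} {js} (≤-<-trans (length-writtenBlocks (steps prog)) TP<N)
  traced = program-trace ρ<2N capacity (steps prog) (initial N P M) {L = inj₁ (output prog) ∷ []} {w = w}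
             (rename-injective {N} {js}) w-unique (≤-reflexive w-length)
             (subst (Spells _ _) word≡w (cons out≡t []))
  oss = proj₁ traced
  bs = proj₁ (proj₂ traced)
  L₀ = proj₁ (proj₂ (proj₂ traced))
  sp = proj₁ (proj₂ (proj₂ (proj₂ traced)))
  tr = proj₁ (proj₂ (proj₂ (proj₂ (proj₂ traced))))
  oss<K = proj₂ (proj₂ (proj₂ (proj₂ (proj₂ traced))))
  W≡ = spells-initial ρ (λ j → rename-< js) sp
  -- At the inputs all `N` letters are blocks, whereas the trace starts with just one, that of the
  -- output cell. The other `N - 1` must have come from reads.
  N≤1+E : N ≤ 1 + E
  N≤1+E = begin
    N                                ≡⟨ trans (blocks-map-inj₁ (λ i → toℕ i / B) w) w-length ⟨
    blocks {P} (inputWord P B w)     ≡⟨ cong (blocks {P}) W≡ ⟨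
    blocks (map container L₀)         ≤⟨ trace-blocks tr ⟩
    1 + T * (P * B)                  ≡⟨ cong suc (*-assoc T P B) ⟨
    1 + E                            ∎
  1≤E : 1 ≤ E
  1≤E = s≤s⁻¹ (≤-trans 2≤N N≤1+E)
  N≤2E : N ≤ 2 * E
  N≤2E = ≤-trans N≤1+E (≤-trans (+-monoˡ-≤ E 1≤E) (≤-reflexive (cong (E +_) (sym (+-identityʳ E)))))
  1≤T : 1 ≤ T
  1≤T with T | 1≤E
  ... | suc _ | _ = s≤s z≤n

-- Block classes, the integer base, and the negated bound.

block-class-size : ∀ {N P B} .{{_ : NonZero B}} {R : List (Fin N)} → Unique R → ∀ (c : Container P) →
                   length (filter (λ i → ≡-dec _≟_ F._≟_ (inj₁ (toℕ i / B)) c) R) ≤ B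
block-class-size {N} {P} {B} {R} u c =
  ≤-trans (≤-reflexive (length-filter R)) (length-mapMaybe-≤ offset (λ i → i) injective R (subst Unique (sym (map-id R)) u))
  where
  offset : Fin N → Maybe (Fin B)
  offset i with ≡-dec _≟_ F._≟_ (inj₁ (toℕ i / B)) c
  ... | yes _ = just (toℕ i mod B)
  ... | no  _ = nothing
  length-filter : ∀ R → length (filter (λ i → ≡-dec _≟_ F._≟_ (inj₁ (toℕ i / B)) c) R) ≡ length (mapMaybe offset R)
  length-filter []      = refl
  length-filter (i ∷ R) with ≡-dec _≟_ F._≟_ (inj₁ (toℕ i / B)) c
  ... | yes _ = cong suc (length-filter R)
  ... | no  _ = length-filter R
  injective : ∀ {x y i} → offset x ≡ just i → offset y ≡ just i → x ≡ y
  injective {x} {y} eq eq′ with ≡-dec _≟_ F._≟_ (inj₁ (toℕ x / B)) c | ≡-dec _≟_ F._≟_ (inj₁ (toℕ y / B)) c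
  ... | yes x∈c | yes y∈c = toℕ-injective (trans (sym (block-offset (toℕ x)))
    (trans (cong₂ (λ q r → q * B + toℕ r) (inj₁-injective (trans x∈c (sym y∈c))) (just-injective (trans eq (sym eq′))))
           (block-offset (toℕ y))))

≤-minℕ : ∀ {a b c} → c ≤ a → c ≤ b → c ≤ minℕ a b
≤-minℕ {a} {b} c≤a c≤b with ≤-total a b
... | inj₁ _ = c≤a
... | inj₂ _ = c≤b

-- The count needs an integer base, so the fraction `dNum / dDen` is rounded down. The part of the
-- cache capacity lost by rounding is less than `P * B`, which `suc d` absorbs.
floor-d : ∀ N M B P .{{_ : NonZero B}} .{{_ : NonZero P}} → ∃ λ d →
          2 ≤ d × NonZero (dDen N M B P) × d * dDen N M B P ≤ dNum N M B P ×
          (∀ c → c ≤ P * M → c ≤ N → c ≤ suc d * (P * B))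
floor-d N M B P with ≤-total (2 * (P * B)) (minℕ (M * P) N)
... | inj₁ 2PB≤m = m / (P * B) , 2≤d , m*n≢0 P B , m/n*n≤m m (P * B) , capacity
  where
  instance PB≢0 : NonZero (P * B)
           PB≢0 = m*n≢0 P B
  m = minℕ (M * P) N
  2≤d : 2 ≤ m / (P * B)
  2≤d = ≤-trans (≤-reflexive (sym (m*n/n≡m 2 (P * B)))) (/-monoˡ-≤ (P * B) 2PB≤m)
  capacity : ∀ c → c ≤ P * M → c ≤ N → c ≤ suc (m / (P * B)) * (P * B)
  capacity c c≤PM c≤N = begin
    c                                          ≤⟨ ≤-minℕ (≤-trans c≤PM (≤-reflexive (*-comm P M))) c≤N ⟩
    m                                          ≡⟨ m≡m%n+[m/n]*n m (P * B) ⟩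
    m % (P * B) + m / (P * B) * (P * B)        ≤⟨ +-monoˡ-≤ _ (m%n≤n m (P * B)) ⟩
    P * B + m / (P * B) * (P * B)              ∎
    where open ≤-Reasoning
... | inj₂ m≤2PB = 2 , ≤-refl , _ , ≤-refl , λ c c≤PM c≤N →
  ≤-trans (≤-minℕ (≤-trans c≤PM (≤-reflexive (*-comm P M))) c≤N) (≤-trans m≤2PB (m≤n+m _ (P * B)))

x+x≤y⇒x<y : ∀ {x y} → x + x ≤ y → 0 < y → x < y
x+x≤y⇒x<y {x} {y} x+x≤y 0<y with x <? y
... | yes x<y = x<y
... | no  x≮y = contradiction (≤-trans (+-mono-≤ (≮⇒≥ x≮y) (≮⇒≥ x≮y)) x+x≤y) (<⇒≱ (m<m+n y 0<y))

-- If both disjuncts of `AtLeastPerm` fail, cancelling the power of `dDen` leaves an inequality in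
-- the integer `d`. The hypothesis `covered` supplies the part of the second disjunct that stems
-- from the `1` in the truncated logarithm.
atLeastPerm-or-small : ∀ x {N M B P d} .{{_ : NonZero (dDen N M B P)}} → d * dDen N M B P ≤ dNum N M B P →
                       (x * P < N → N ≤ x * P * B) →
                       AtLeastPerm x N M B P ⊎ (x * P < N × d ^ (x * P * B) * B ^ N ≤ N ^ N)
atLeastPerm-or-small x {N} {M} {B} {P} {d} dQ≤A covered
  with ≤-<-connex N (x * P) | ≤-<-connex (N ^ N * dDen N M B P ^ (x * P * B)) (dNum N M B P ^ (x * P * B) * B ^ N)
... | inj₁ N≤xP | _           = inj₁ (inj₁ N≤xP)
... | inj₂ xP<N | inj₁ enough = inj₁ (inj₂ (covered xP<N , enough))
... | inj₂ xP<N | inj₂ few    = inj₂ (xP<N , *-cancelʳ-≤ _ _ (Q ^ e) {{m^n≢0 Q e}} (begin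
  d ^ e * B ^ N * Q ^ e      ≡⟨ *-assoc (d ^ e) (B ^ N) (Q ^ e) ⟩
  d ^ e * (B ^ N * Q ^ e)    ≡⟨ cong (d ^ e *_) (*-comm (B ^ N) (Q ^ e)) ⟩
  d ^ e * (Q ^ e * B ^ N)    ≡⟨ *-assoc (d ^ e) (Q ^ e) (B ^ N) ⟨
  d ^ e * Q ^ e * B ^ N      ≡⟨ cong (_* B ^ N) (^-distribʳ-* d Q e) ⟨
  (d * Q) ^ e * B ^ N        ≤⟨ *-monoˡ-≤ (B ^ N) (^-monoˡ-≤ e dQ≤A) ⟩
  dNum N M B P ^ e * B ^ N   ≤⟨ <⇒≤ few ⟩
  N ^ N * Q ^ e              ∎))
  where
  open ≤-Reasoning
  Q = dDen N M B P
  e = x * P * B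

-- One permutation that is hard for every cost.

module HardInput {N B P d : ℕ} .{{B≢0 : NonZero B}} (5≤N : 5 ≤ N) (1≤P : 1 ≤ P) (B≤N : B ≤ N) (2≤d : 2 ≤ d) where

  Cheap : ℕ → Set
  Cheap T = 27 * T * P ≤ N × N ≤ 2 * (T * P * B) × d ^ (27 * T * P * B) * B ^ N ≤ N ^ N

  cheap? : ∀ T → Dec (Cheap T)
  cheap? T = 27 * T * P ≤? N ×-dec (N ≤? 2 * (T * P * B) ×-dec d ^ (27 * T * P * B) * B ^ N ≤? N ^ N)

  private
    instance
      N≢0 : NonZero N
      N≢0 = >-nonZero (≤-trans (s≤s z≤n) 5≤N)

  -- The counting bound holds only under `Cheap`. Other values of `T` contribute an empty list, so
  -- the union can range over all `T < N`.
  cheapCandidates : ℕ → List (List (Container P))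
  cheapCandidates T with cheap? T
  ... | yes _ = candidates N P B d T
  ... | no  _ = []

  ∈-cheapCandidates : ∀ {T W} → Cheap T → W ∈ candidates N P B d T → W ∈ cheapCandidates T
  ∈-cheapCandidates {T} cheap W∈ with cheap? T
  ... | yes _     = W∈
  ... | no ¬cheap = contradiction cheap ¬cheap

  length-cheapCandidates : ∀ T → length (cheapCandidates T) * (2 * N * B ^ N) ≤ N !
  length-cheapCandidates T with cheap? T
  ... | no  _ = z≤n
  ... | yes (few , N≤2E , small) = ≤-trans (*-monoˡ-≤ (2 * N * B ^ N) (length-candidates N P B d T))
          (traceCount-bound {T = T} 5≤N (>-nonZero⁻¹ B) 1≤P B≤N 2≤d few N≤2E small)

  -- Costs `T < N` suffice: otherwise `N ≤ T * P`, and the program already meets the linear bound.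
  -- Of the spare factor `2 * N` in `length-cheapCandidates`, the `N` pays for this union and the
  -- `2` makes `few-candidates` strict.
  allCandidates : List (List (Container P))
  allCandidates = concatMap cheapCandidates (upTo N)

  few-candidates : length allCandidates * B ^ N < N !
  few-candidates = x+x≤y⇒x<y (*-cancelˡ-≤ N (begin
    N * (x + x)                              ≡⟨ identity N (length allCandidates) (B ^ N) ⟩
    length allCandidates * (2 * N * B ^ N)   ≤⟨ length-concatMap-≤ cheapCandidates (upTo N) length-cheapCandidates ⟩
    length (upTo N) * N !                    ≡⟨ cong (_* N !) (length-upTo N) ⟩
    N * N !                                  ∎)) (1≤n! N)
    where
    open ≤-Reasoning
    x = length allCandidates * B ^ N
    identity : ∀ n l b → n * (l * b + l * b) ≡ l * (2 * n * b)
    identity = solve-∀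

  hardInput : ∃ λ (π : Permutation′ N) → ∀ T → T < N → Cheap T → inputWord P B (tabulate (π ⟨$⟩ʳ_)) ∉ candidates N P B d T
  hardInput with Avoidance.avoid (≡-dec _≟_ F._≟_) (λ i → inj₁ (toℕ i / B)) B block-class-size
                   N allCandidates (length-tabulate (λ i → i)) (allFin⁺ N) few-candidates
  ... | R , R↭ , R∉ with ↭allFin⇒permutation R↭
  ...   | π , refl = π , λ T T<N cheap W∈ → R∉ (∈-concatMap⁺ cheapCandidates (lose (∈-upTo⁺ T<N) (∈-cheapCandidates cheap W∈)))

theorem2 : Σ ℕ λ k → Σ ℕ λ n₀ →
    ∀ (N M B P : ℕ) → n₀ ≤ N → 1 ≤ B → B ≤ M → 1 ≤ P → P * B ≤ N →
    Σ (Permutation′ N) λ π →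
    ∀ (prog : Program P M B) → Valid prog → Correct N P M B π prog →
    AtLeastPerm (k * cost (steps prog)) N M B P
-- The factor is `27 = 10 + 12 + 5`, the shares of `a≤`, `c≤` and `names-bound`; the threshold 5 is
-- what gives `5 * N ≤ N * N` in `names-bound`.
theorem2 = 27 , 5 , λ N M B P 5≤N 1≤B _ 1≤P PB≤N → bound N M B P {{>-nonZero 1≤B}} {{>-nonZero 1≤P}} 5≤N 1≤P PB≤N
  where
  bound : ∀ N M B P .{{_ : NonZero B}} .{{_ : NonZero P}} → 5 ≤ N → 1 ≤ P → P * B ≤ N →
          Σ (Permutation′ N) λ π → ∀ (prog : Program P M B) → Valid prog → Correct N P M B π prog →
          AtLeastPerm (27 * cost (steps prog)) N M B P
  bound N M B P 5≤N 1≤P PB≤N with floor-d N M B P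
  ... | d , 2≤d , Q≢0 , dQ≤A , capacity = π , atLeast
    where
    open HardInput {N} {B} {P} {d} 5≤N 1≤P (≤-trans (m≤n*m B P) PB≤N) 2≤d
    open ≤-Reasoning
    π = proj₁ hardInput
    atLeast : ∀ (prog : Program P M B) → Valid prog → Correct N P M B π prog → AtLeastPerm (27 * cost (steps prog)) N M B P
    atLeast prog _ correct = [ (λ le → le) , (λ (few , small) → contradiction (proj₂ (solved few))
        (proj₂ hardInput T (≤-<-trans (m≤m*n T P) (TP<N few)) (<⇒≤ few , proj₁ (solved few) , small))) ]′
      (atLeastPerm-or-small (27 * T) {{Q≢0}} dQ≤A (λ few → ≤-trans (proj₁ (solved few)) 2E≤e))
      where
      T = cost (steps prog)
      27TP≡ : 27 * (T * P) ≡ 27 * T * P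
      27TP≡ = sym (*-assoc 27 T P)
      TP<N : 27 * T * P < N → T * P < N
      TP<N = ≤-<-trans (≤-trans (m≤n*m (T * P) 27) (≤-reflexive 27TP≡))
      solved : 27 * T * P < N → N ≤ 2 * (T * P * B) × inputWord P B (tabulate (π ⟨$⟩ʳ_)) ∈ candidates N P B d T
      solved few = correct⇒candidate {d = d} {π = π} prog correct capacity (≤-trans (s≤s (s≤s z≤n)) 5≤N) (TP<N few)
      2E≤e : 2 * (T * P * B) ≤ 27 * T * P * B
      2E≤e = begin
        2 * (T * P * B)     ≤⟨ *-monoˡ-≤ (T * P * B) (m≤m+n 2 25) ⟩
        27 * (T * P * B)    ≡⟨ *-assoc 27 (T * P) B ⟨
        27 * (T * P) * B    ≡⟨ cong (_* B) 27TP≡ ⟩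
        27 * T * P * B      ∎
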